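{- Let $k\ge 1$, let $a\in\mathbb{C}$ with $a\neq 0$, let $a_1,\dots,a_k,a_1^*,\dots,a_k^*\in\mathbb{Q}$, and let $\zeta_1,\dots,\zeta_k,\zeta_1^*,\dots,\zeta_k^*$ be roots of unity such that $$\sum_{i=1}^k a_i\zeta_i=a,\qquad \sum_{j=1}^k a_j^*\zeta_j^*=a,$$ and such that $\sum_{i\in I}a_i\zeta_i\neq 0$ for every $I$ with $\emptyset\neq I\subsetneq[k]$ and $\sum_{j\in J}a_j^*\zeta_j^*\neq 0$ for every $J$ with $\emptyset\neq J\subsetneq[k]$. Let $m=\prod_{p\le 2k,\ p\text{ prime}}p$. Then for every $j\in[k]$ there is an $i\in[k]$ such that $(\zeta_j^*/\zeta_i)^m=1$.
   Context: $[k]=\{1,\dots,k\}$. -}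

module Defs where

open import Algebra.Bundles using (CommutativeRing; Semiring)
open import Algebra.Definitions using (Invertible)
import Algebra.Definitions.RawSemiring as RawSemiringDefinitions
open import Data.Bool.Base using (if_then_else_)
open import Data.Fin.Base using (Fin)
open import Data.Fin.Subset using (Subset)
open import Data.List.Base using (filter; upTo)
open import Data.Nat.Base as ℕ using (ℕ; zero; suc)
open import Data.Nat.ListAction using (product)
import Data.Nat.Properties as ℕ
open import Data.Nat.Primality using (prime?)
open import Data.Product.Base using (Σ; _×_; _,_; proj₁; proj₂)
open import Data.Rational.Base using (ℚ; 0ℚ; 1ℚ; ½; _+_; _*_; _-_; -_; ∣_∣; _<_; Positive; positive; nonNegative; 1/_)
open import Data.Rational.Properties hiding (_≟_; +-identity; *-identity; +-inverse)
open import Data.Rational.Solver using (module +-*-Solver)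
open import Data.Vec.Base using (lookup)
open import Level using (0ℓ)
open import Relation.Binary.PropositionalEquality using (_≡_; refl; sym; trans; cong; subst)
open import Relation.Binary.Structures using (IsEquivalence)

------------------------------------------------------------------------
-- Real numbers: Cauchy sequences of rationals, with the usual setoid
-- equality "the difference tends to zero".

Eventually : (ℕ → Set) → Set
Eventually P = Σ ℕ λ N → ∀ n → N ℕ.≤ n → P n

Cauchy : (ℕ → ℚ) → Set
Cauchy f = ∀ ε → 0ℚ < ε →
  Σ ℕ λ N → ∀ m n → N ℕ.≤ m → N ℕ.≤ n → ∣ f m - f n ∣ < ε

record ℝ : Set where
  constructor mkℝ
  field
    seq    : ℕ → ℚ
    cauchy : Cauchy seq
open ℝ public

infix 4 _≈ᴿ_

record _≈ᴿ_ (x y : ℝ) : Set where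
  constructor mk≈ᴿ
  field
    limit : ∀ ε → 0ℚ < ε → Eventually (λ n → ∣ seq x n - seq y n ∣ < ε)
open _≈ᴿ_ public

private
  ∣p-p∣≡0 : ∀ p → ∣ p - p ∣ ≡ 0ℚ
  ∣p-p∣≡0 p = cong ∣_∣ (+-inverseʳ p)

  halves : ∀ ε → ½ * ε + ½ * ε ≡ ε
  halves ε = trans (sym (*-distribʳ-+ ε ½ ½)) (*-identityˡ ε)

  half-pos : ∀ {ε} → 0ℚ < ε → 0ℚ < ½ * ε
  half-pos {ε} 0<ε =
    positive⁻¹ (½ * ε) {{pos*pos⇒pos ½ ε {{positive 0<ε}}}}

  +-close : ∀ {ε} p q r → p ≡ q + r →
            ∣ q ∣ < ½ * ε → ∣ r ∣ < ½ * ε → ∣ p ∣ < ε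
  +-close {ε} p q r refl q< r< =
    subst (∣ p ∣ <_) (halves ε)
      (≤-<-trans (∣p+q∣≤∣p∣+∣q∣ q r) (+-mono-< q< r<))

  open +-*-Solver using (solve; _:+_; _:*_; _:-_; :-_; _:=_)

  +-split : ∀ a b c d → (a + b) - (c + d) ≡ (a - c) + (b - d)
  +-split = solve 4 (λ a b c d →
    (a :+ b) :- (c :+ d) := (a :- c) :+ (b :- d)) refl

  *-split : ∀ a b c d → a * b - c * d ≡ a * (b - d) + d * (a - c)
  *-split = solve 4 (λ a b c d →
    a :* b :- c :* d := a :* (b :- d) :+ d :* (a :- c)) refl

  swap-split : ∀ a b → a - b ≡ - (b - a)
  swap-split = solve 2 (λ a b → a :- b := :- (b :- a)) refl

  neg-split : ∀ a b → (- a) - (- b) ≡ - (a - b)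
  neg-split = solve 2 (λ a b → (:- a) :- (:- b) := :- (a :- b)) refl

  via : ∀ a b c → a - c ≡ (a - b) + (b - c)
  via = solve 3 (λ a b c → a :- c := (a :- b) :+ (b :- c)) refl

  back : ∀ a b → a ≡ (a - b) + b
  back = solve 2 (λ a b → a := (a :- b) :+ b) refl

  -- An eventual bound B for f, and the point from which it holds.
  bounded : ∀ {f} → Cauchy f →
            Σ ℚ λ B → 0ℚ < B × Eventually (λ n → ∣ f n ∣ < B)
  bounded {f} c with c 1ℚ (positive⁻¹ 1ℚ)
  ... | N , close = 1ℚ + ∣ f N ∣ , 0<B , N , bound
    where
    0<B : 0ℚ < 1ℚ + ∣ f N ∣
    0<B = +-mono-<-≤ (positive⁻¹ 1ℚ) (0≤∣p∣ (f N))

    bound : ∀ n → N ℕ.≤ n → ∣ f n ∣ < 1ℚ + ∣ f N ∣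
    bound n N≤n = subst (λ z → ∣ z ∣ < 1ℚ + ∣ f N ∣) (sym (back (f n) (f N)))
      (≤-<-trans (∣p+q∣≤∣p∣+∣q∣ (f n - f N) (f N))
        (+-monoˡ-< ∣ f N ∣ (close n N N≤n ℕ.≤-refl)))

  -- A tolerance for the factors which guarantees ε for the product.
  tolerance : ∀ A B ε → 0ℚ < A → 0ℚ < B → 0ℚ < ε →
              Σ ℚ λ δ → 0ℚ < δ × A * δ + B * δ ≡ ε
  tolerance A B ε 0<A 0<B 0<ε = δ , 0<δ , eq
    where
    instance
      A+B-pos : Positive (A + B)
      A+B-pos = positive (+-mono-< 0<A 0<B)

      A+B-nz = pos⇒nonZero (A + B)

    δ : ℚ
    δ = 1/ (A + B) * ε

    0<δ : 0ℚ < δ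
    0<δ = positive⁻¹ δ
      {{pos*pos⇒pos (1/ (A + B)) {{1/pos⇒pos (A + B)}} ε {{positive 0<ε}}}}

    eq : A * δ + B * δ ≡ ε
    eq = trans (sym (*-distribʳ-+ δ A B))
        (trans (sym (*-assoc (A + B) (1/ (A + B)) ε))
        (trans (cong (_* ε) (*-inverseʳ (A + B))) (*-identityˡ ε)))

  *-bound : ∀ {A δ} p q → 0ℚ < A → ∣ p ∣ < A → ∣ q ∣ < δ → ∣ p * q ∣ < A * δ
  *-bound {A} {δ} p q 0<A p< q< =
    subst (_< A * δ) (sym (∣p*q∣≡∣p∣*∣q∣ p q))
      (≤-<-trans
        (*-monoʳ-≤-nonNeg ∣ q ∣ {{nonNegative (0≤∣p∣ q)}} (<⇒≤ p<))
        (*-monoʳ-<-pos A {{positive 0<A}} q<))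

  *-close : ∀ {A B δ ε} a b c d → 0ℚ < A → 0ℚ < B → A * δ + B * δ ≡ ε →
            ∣ a ∣ < A → ∣ d ∣ < B → ∣ b - d ∣ < δ → ∣ a - c ∣ < δ →
            ∣ a * b - c * d ∣ < ε
  *-close {A} {B} {δ} {ε} a b c d 0<A 0<B eq a< d< bd< ac< =
    subst (λ z → ∣ z ∣ < ε) (sym (*-split a b c d))
      (subst (∣ a * (b - d) + d * (a - c) ∣ <_) eq
        (≤-<-trans (∣p+q∣≤∣p∣+∣q∣ (a * (b - d)) (d * (a - c)))
          (+-mono-< (*-bound a (b - d) 0<A a< bd<)
                    (*-bound d (a - c) 0<B d< ac<))))

  ⊔-l : ∀ M N {n} → M ℕ.⊔ N ℕ.≤ n → M ℕ.≤ n
  ⊔-l M N = ℕ.≤-trans (ℕ.m≤m⊔n M N)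

  ⊔-r : ∀ M N {n} → M ℕ.⊔ N ℕ.≤ n → N ℕ.≤ n
  ⊔-r M N = ℕ.≤-trans (ℕ.m≤n⊔m M N)

  both : ∀ {P Q : ℕ → Set} → Eventually P → Eventually Q →
         Eventually (λ n → P n × Q n)
  both (M , p) (N , q) = M ℕ.⊔ N , λ n h → p n (⊔-l M N h) , q n (⊔-r M N h)

abstract
  private
    constCauchy : ∀ q → Cauchy (λ _ → q)
    constCauchy q ε 0<ε = 0 , λ _ _ _ _ → subst (_< ε) (sym (∣p-p∣≡0 q)) 0<ε

    +-cauchy : ∀ f g → Cauchy f → Cauchy g → Cauchy (λ n → f n + g n)
    +-cauchy f g cf cg ε 0<ε
      with cf (½ * ε) (half-pos 0<ε) | cg (½ * ε) (half-pos 0<ε)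
    ... | M , F | N , G = M ℕ.⊔ N , λ m n hm hn →
      +-close _ (f m - f n) (g m - g n) (+-split (f m) (g m) (f n) (g n))
        (F m n (⊔-l M N hm) (⊔-l M N hn)) (G m n (⊔-r M N hm) (⊔-r M N hn))

    neg-cauchy : ∀ f → Cauchy f → Cauchy (λ n → - f n)
    neg-cauchy f cf ε 0<ε with cf ε 0<ε
    ... | N , F = N , λ m n hm hn →
      subst (_< ε)
        (sym (trans (cong ∣_∣ (neg-split (f m) (f n))) (∣-p∣≡∣p∣ (f m - f n))))
        (F m n hm hn)

    *-cauchy : ∀ f g → Cauchy f → Cauchy g → Cauchy (λ n → f n * g n)
    *-cauchy f g cf cg ε 0<ε =
      let A , 0<A , K , fb = bounded cf
          B , 0<B , L , gb = bounded cg
          δ , 0<δ , eq = tolerance A B ε 0<A 0<B 0<ε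
          M , F = cf δ 0<δ
          N , G = cg δ 0<δ
      in (K ℕ.⊔ L) ℕ.⊔ (M ℕ.⊔ N) , λ m n hm hn →
      let hm₁ = ⊔-l (K ℕ.⊔ L) (M ℕ.⊔ N) hm
          hn₁ = ⊔-l (K ℕ.⊔ L) (M ℕ.⊔ N) hn
          hm₂ = ⊔-r (K ℕ.⊔ L) (M ℕ.⊔ N) hm
          hn₂ = ⊔-r (K ℕ.⊔ L) (M ℕ.⊔ N) hn
      in *-close (f m) (g m) (f n) (g n) 0<A 0<B eq
           (fb m (⊔-l K L hm₁)) (gb n (⊔-r K L hn₁))
           (G m n (⊔-r M N hm₂) (⊔-r M N hn₂))
           (F m n (⊔-l M N hm₂) (⊔-l M N hn₂))

infixl 6 _+ᴿ_
infixl 7 _*ᴿ_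
infix  8 -ᴿ_

fromℚᴿ : ℚ → ℝ
fromℚᴿ q = mkℝ (λ _ → q) (constCauchy q)

0ᴿ 1ᴿ : ℝ
0ᴿ = fromℚᴿ 0ℚ
1ᴿ = fromℚᴿ 1ℚ

_+ᴿ_ : ℝ → ℝ → ℝ
x +ᴿ y = mkℝ (λ n → seq x n + seq y n) (+-cauchy (seq x) (seq y) (cauchy x) (cauchy y))

_*ᴿ_ : ℝ → ℝ → ℝ
x *ᴿ y = mkℝ (λ n → seq x n * seq y n) (*-cauchy (seq x) (seq y) (cauchy x) (cauchy y))

-ᴿ_ : ℝ → ℝ
-ᴿ x = mkℝ (λ n → - seq x n) (neg-cauchy (seq x) (cauchy x))

private
  pointwise : ∀ {x y} → (∀ n → seq x n ≡ seq y n) → x ≈ᴿ y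
  pointwise {x} {y} eq = mk≈ᴿ λ ε 0<ε → 0 , λ n _ →
    subst (_< ε)
      (sym (trans (cong (λ z → ∣ z - seq y n ∣) (eq n)) (∣p-p∣≡0 (seq y n))))
      0<ε

  ≈ᴿ-sym : ∀ {x y} → x ≈ᴿ y → y ≈ᴿ x
  ≈ᴿ-sym {x} {y} e = mk≈ᴿ λ ε 0<ε → let N , h = limit e ε 0<ε in N , λ n N≤n →
    subst (_< ε)
      (sym (trans (cong ∣_∣ (swap-split (seq y n) (seq x n)))
                  (∣-p∣≡∣p∣ (seq x n - seq y n))))
      (h n N≤n)

  ≈ᴿ-trans : ∀ {x y z} → x ≈ᴿ y → y ≈ᴿ z → x ≈ᴿ z
  ≈ᴿ-trans {x} {y} {z} e f = mk≈ᴿ λ ε 0<ε →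
    let N , h = both (limit e (½ * ε) (half-pos 0<ε))
                     (limit f (½ * ε) (half-pos 0<ε))
    in N , λ n N≤n → +-close _ (seq x n - seq y n) (seq y n - seq z n)
         (via (seq x n) (seq y n) (seq z n)) (proj₁ (h n N≤n)) (proj₂ (h n N≤n))

  +ᴿ-cong : ∀ {x y u v} → x ≈ᴿ y → u ≈ᴿ v → x +ᴿ u ≈ᴿ y +ᴿ v
  +ᴿ-cong {x} {y} {u} {v} e f = mk≈ᴿ λ ε 0<ε →
    let N , h = both (limit e (½ * ε) (half-pos 0<ε))
                     (limit f (½ * ε) (half-pos 0<ε))
    in N , λ n N≤n → +-close _ (seq x n - seq y n) (seq u n - seq v n)
         (+-split (seq x n) (seq u n) (seq y n) (seq v n))
         (proj₁ (h n N≤n)) (proj₂ (h n N≤n))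

  -ᴿ-cong : ∀ {x y} → x ≈ᴿ y → -ᴿ x ≈ᴿ -ᴿ y
  -ᴿ-cong {x} {y} e = mk≈ᴿ λ ε 0<ε → let N , h = limit e ε 0<ε in N , λ n N≤n →
    subst (_< ε)
      (sym (trans (cong ∣_∣ (neg-split (seq x n) (seq y n)))
                  (∣-p∣≡∣p∣ (seq x n - seq y n))))
      (h n N≤n)

  *ᴿ-cong : ∀ {x y u v} → x ≈ᴿ y → u ≈ᴿ v → x *ᴿ u ≈ᴿ y *ᴿ v
  *ᴿ-cong {x} {y} {u} {v} e f = mk≈ᴿ λ ε 0<ε →
    let A , 0<A , xb = bounded (cauchy x)
        B , 0<B , vb = bounded (cauchy v)
        δ , 0<δ , eq = tolerance A B ε 0<A 0<B 0<ε
        N , h = both (both xb vb) (both (limit f δ 0<δ) (limit e δ 0<δ))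
    in N , λ n N≤n → let (p , q) , (r , s) = h n N≤n in
         *-close (seq x n) (seq u n) (seq y n) (seq v n) 0<A 0<B eq p q r s

ℝ-commutativeRing : CommutativeRing 0ℓ 0ℓ
ℝ-commutativeRing = record
  { Carrier = ℝ
  ; _≈_     = _≈ᴿ_
  ; _+_     = _+ᴿ_
  ; _*_     = _*ᴿ_
  ; -_      = -ᴿ_
  ; 0#      = 0ᴿ
  ; 1#      = 1ᴿ
  ; isCommutativeRing = record
    { isRing = record
      { +-isAbelianGroup = record
        { isGroup = record
          { isMonoid = record
            { isSemigroup = record
              { isMagma = record
                { isEquivalence = record
                  { refl  = pointwise λ _ → refl
                  ; sym   = ≈ᴿ-sym
                  ; trans = ≈ᴿ-trans
                  }
                ; ∙-cong = +ᴿ-cong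
                }
              ; assoc = λ x y z → pointwise λ n →
                  +-assoc (seq x n) (seq y n) (seq z n)
              }
            ; identity = (λ x → pointwise λ n → +-identityˡ (seq x n))
                       , (λ x → pointwise λ n → +-identityʳ (seq x n))
            }
          ; inverse = (λ x → pointwise λ n → +-inverseˡ (seq x n))
                    , (λ x → pointwise λ n → +-inverseʳ (seq x n))
          ; ⁻¹-cong = -ᴿ-cong
          }
        ; comm = λ x y → pointwise λ n → +-comm (seq x n) (seq y n)
        }
      ; *-cong = *ᴿ-cong
      ; *-assoc = λ x y z → pointwise λ n →
          *-assoc (seq x n) (seq y n) (seq z n)
      ; *-identity = (λ x → pointwise λ n → *-identityˡ (seq x n))
                   , (λ x → pointwise λ n → *-identityʳ (seq x n))
      ; distrib = (λ x y z → pointwise λ n →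
                    *-distribˡ-+ (seq x n) (seq y n) (seq z n))
                , (λ x y z → pointwise λ n →
                    *-distribʳ-+ (seq x n) (seq y n) (seq z n))
      }
    ; *-comm = λ x y → pointwise λ n → *-comm (seq x n) (seq y n)
    }
  }

------------------------------------------------------------------------
-- Complex numbers

infix  4 _≈ᶜ_
infixl 6 _+ᶜ_
infixl 7 _*ᶜ_
infix  8 -ᶜ_

record ℂ : Set where
  constructor _+i_
  field
    re im : ℝ
open ℂ public

record _≈ᶜ_ (z w : ℂ) : Set where
  constructor mk≈ᶜ
  field
    re-≈ : re z ≈ᴿ re w
    im-≈ : im z ≈ᴿ im w
open _≈ᶜ_ public

fromℚ : ℚ → ℂ
fromℚ q = fromℚᴿ q +i 0ᴿ

0ᶜ 1ᶜ : ℂ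
0ᶜ = fromℚ 0ℚ
1ᶜ = fromℚ 1ℚ

_+ᶜ_ : ℂ → ℂ → ℂ
z +ᶜ w = (re z +ᴿ re w) +i (im z +ᴿ im w)

_*ᶜ_ : ℂ → ℂ → ℂ
z *ᶜ w = (re z *ᴿ re w +ᴿ -ᴿ (im z *ᴿ im w))
      +i (re z *ᴿ im w +ᴿ im z *ᴿ re w)

-ᶜ_ : ℂ → ℂ
-ᶜ z = (-ᴿ re z) +i (-ᴿ im z)

private
  module R = CommutativeRing ℝ-commutativeRing

  open +-*-Solver using (solve; con; _:+_; _:*_; :-_; _:=_)

  assoc-re : ∀ a b c d e f →
    (a * c + - (b * d)) * e + - ((a * d + b * c) * f)
      ≡ a * (c * e + - (d * f)) + - (b * (c * f + d * e))
  assoc-re = solve 6 (λ a b c d e f →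
    (a :* c :+ :- (b :* d)) :* e :+ :- ((a :* d :+ b :* c) :* f)
      := a :* (c :* e :+ :- (d :* f)) :+ :- (b :* (c :* f :+ d :* e))) refl

  assoc-im : ∀ a b c d e f →
    (a * c + - (b * d)) * f + (a * d + b * c) * e
      ≡ a * (c * f + d * e) + b * (c * e + - (d * f))
  assoc-im = solve 6 (λ a b c d e f →
    (a :* c :+ :- (b :* d)) :* f :+ (a :* d :+ b :* c) :* e
      := a :* (c :* f :+ d :* e) :+ b :* (c :* e :+ :- (d :* f))) refl

  distribˡ-re : ∀ a b c d e f →
    a * (c + e) + - (b * (d + f)) ≡ (a * c + - (b * d)) + (a * e + - (b * f))
  distribˡ-re = solve 6 (λ a b c d e f →
    a :* (c :+ e) :+ :- (b :* (d :+ f))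
      := (a :* c :+ :- (b :* d)) :+ (a :* e :+ :- (b :* f))) refl

  distribˡ-im : ∀ a b c d e f →
    a * (d + f) + b * (c + e) ≡ (a * d + b * c) + (a * f + b * e)
  distribˡ-im = solve 6 (λ a b c d e f →
    a :* (d :+ f) :+ b :* (c :+ e)
      := (a :* d :+ b :* c) :+ (a :* f :+ b :* e)) refl

  comm-re : ∀ a b c d → a * c + - (b * d) ≡ c * a + - (d * b)
  comm-re = solve 4 (λ a b c d →
    a :* c :+ :- (b :* d) := c :* a :+ :- (d :* b)) refl

  comm-im : ∀ a b c d → a * d + b * c ≡ c * b + d * a
  comm-im = solve 4 (λ a b c d → a :* d :+ b :* c := c :* b :+ d :* a) refl

  identity-re : ∀ a b → 1ℚ * a + - (0ℚ * b) ≡ a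
  identity-re = solve 2 (λ a b →
    con 1ℚ :* a :+ :- (con 0ℚ :* b) := a) refl

  identity-im : ∀ a b → 1ℚ * b + 0ℚ * a ≡ b
  identity-im = solve 2 (λ a b → con 1ℚ :* b :+ con 0ℚ :* a := b) refl

  ≈ᶜ-isEquivalence : IsEquivalence _≈ᶜ_
  ≈ᶜ-isEquivalence = record
    { refl  = mk≈ᶜ R.refl R.refl
    ; sym   = λ e → mk≈ᶜ (R.sym (re-≈ e)) (R.sym (im-≈ e))
    ; trans = λ e f → mk≈ᶜ (R.trans (re-≈ e) (re-≈ f)) (R.trans (im-≈ e) (im-≈ f))
    }

  module E = IsEquivalence ≈ᶜ-isEquivalence

  +ᶜ-cong : ∀ {z w u v} → z ≈ᶜ w → u ≈ᶜ v → z +ᶜ u ≈ᶜ w +ᶜ v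
  +ᶜ-cong e f = mk≈ᶜ (R.+-cong (re-≈ e) (re-≈ f)) (R.+-cong (im-≈ e) (im-≈ f))

  *ᶜ-cong : ∀ {z w u v} → z ≈ᶜ w → u ≈ᶜ v → z *ᶜ u ≈ᶜ w *ᶜ v
  *ᶜ-cong e f = mk≈ᶜ
    (R.+-cong (R.*-cong (re-≈ e) (re-≈ f)) (R.-‿cong (R.*-cong (im-≈ e) (im-≈ f))))
    (R.+-cong (R.*-cong (re-≈ e) (im-≈ f)) (R.*-cong (im-≈ e) (re-≈ f)))

  *ᶜ-comm : ∀ z w → z *ᶜ w ≈ᶜ w *ᶜ z
  *ᶜ-comm z w = mk≈ᶜ
    (pointwise λ n →
      comm-re (seq (re z) n) (seq (im z) n) (seq (re w) n) (seq (im w) n))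
    (pointwise λ n →
      comm-im (seq (re z) n) (seq (im z) n) (seq (re w) n) (seq (im w) n))

  *ᶜ-identityˡ : ∀ z → 1ᶜ *ᶜ z ≈ᶜ z
  *ᶜ-identityˡ z = mk≈ᶜ
    (pointwise λ n → identity-re (seq (re z) n) (seq (im z) n))
    (pointwise λ n → identity-im (seq (re z) n) (seq (im z) n))

  *ᶜ-distribˡ : ∀ z w u → z *ᶜ (w +ᶜ u) ≈ᶜ z *ᶜ w +ᶜ z *ᶜ u
  *ᶜ-distribˡ z w u = mk≈ᶜ
    (pointwise λ n →
      distribˡ-re (seq (re z) n) (seq (im z) n) (seq (re w) n) (seq (im w) n)
        (seq (re u) n) (seq (im u) n))
    (pointwise λ n →
      distribˡ-im (seq (re z) n) (seq (im z) n) (seq (re w) n) (seq (im w) n)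
        (seq (re u) n) (seq (im u) n))

ℂ-commutativeRing : CommutativeRing 0ℓ 0ℓ
ℂ-commutativeRing = record
  { Carrier = ℂ
  ; _≈_     = _≈ᶜ_
  ; _+_     = _+ᶜ_
  ; _*_     = _*ᶜ_
  ; -_      = -ᶜ_
  ; 0#      = 0ᶜ
  ; 1#      = 1ᶜ
  ; isCommutativeRing = record
    { isRing = record
      { +-isAbelianGroup = record
        { isGroup = record
          { isMonoid = record
            { isSemigroup = record
              { isMagma = record
                { isEquivalence = ≈ᶜ-isEquivalence
                ; ∙-cong = +ᶜ-cong
                }
              ; assoc = λ z w u → mk≈ᶜ (R.+-assoc (re z) (re w) (re u))
                                       (R.+-assoc (im z) (im w) (im u))
              }
            ; identity =
                (λ z → mk≈ᶜ (R.+-identityˡ (re z)) (R.+-identityˡ (im z)))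
              , (λ z → mk≈ᶜ (R.+-identityʳ (re z)) (R.+-identityʳ (im z)))
            }
          ; inverse =
              (λ z → mk≈ᶜ (R.-‿inverseˡ (re z)) (R.-‿inverseˡ (im z)))
            , (λ z → mk≈ᶜ (R.-‿inverseʳ (re z)) (R.-‿inverseʳ (im z)))
          ; ⁻¹-cong = λ e → mk≈ᶜ (R.-‿cong (re-≈ e)) (R.-‿cong (im-≈ e))
          }
        ; comm = λ z w → mk≈ᶜ (R.+-comm (re z) (re w)) (R.+-comm (im z) (im w))
        }
      ; *-cong = *ᶜ-cong
      ; *-assoc = λ z w u → mk≈ᶜ
          (pointwise λ n →
            assoc-re (seq (re z) n) (seq (im z) n) (seq (re w) n) (seq (im w) n)
              (seq (re u) n) (seq (im u) n))
          (pointwise λ n →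
            assoc-im (seq (re z) n) (seq (im z) n) (seq (re w) n) (seq (im w) n)
              (seq (re u) n) (seq (im u) n))
      ; *-identity =
          *ᶜ-identityˡ , λ z → E.trans (*ᶜ-comm z 1ᶜ) (*ᶜ-identityˡ z)
      ; distrib =
          *ᶜ-distribˡ
        , λ z w u → E.trans (*ᶜ-comm (w +ᶜ u) z)
            (E.trans (*ᶜ-distribˡ z w u)
                     (+ᶜ-cong (*ᶜ-comm z w) (*ᶜ-comm z u)))
      }
    ; *-comm = *ᶜ-comm
    }
  }

open RawSemiringDefinitions (Semiring.rawSemiring (CommutativeRing.semiring ℂ-commutativeRing)) public
  using () renaming (sum to sumᶜ; _^_ to _^ᶜ_)

sumOver : ∀ {k} → Subset k → (Fin k → ℂ) → ℂ
sumOver I f = sumᶜ λ i → if lookup I i then f i else 0ᶜ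

-- ¬ (w ≈ᶜ 0ᶜ) does not constructively yield an inverse of w, so division takes
-- one as an instance argument.
infixl 7 _/ᶜ_

_/ᶜ_ : (z w : ℂ) {{_ : Invertible _≈ᶜ_ 1ᶜ _*ᶜ_ w}} → ℂ
(z /ᶜ w) {{w⁻¹ , _}} = z *ᶜ w⁻¹

record IsRootOfUnity (z : ℂ) : Set where
  field
    exponent     : ℕ
    exponent≥1   : exponent ℕ.≥ 1
    z^exponent≈1 : z ^ᶜ exponent ≈ᶜ 1ᶜ

rootOfUnity⇒invertible : ∀ {z} → IsRootOfUnity z → Invertible _≈ᶜ_ 1ᶜ _*ᶜ_ z
rootOfUnity⇒invertible {z} record { exponent = suc n ; z^exponent≈1 = z^1+n≈1 } =
  z ^ᶜ n , E.trans (*ᶜ-comm (z ^ᶜ n) z) z^1+n≈1 , z^1+n≈1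

-- The product of all primes p ≤ n.
primorial : ℕ → ℕ
primorial n = product (filter prime? (upTo (suc n)))

{-# OPTIONS --safe #-}

-- Put η = ζ/ζ*ⱼ for all 2k roots involved, so that Σ z η = 0 with integers z, the
-- two halves of the sum cancelling. Let ηᴺ = 1 for all η. Conjugation: for a prime
-- to N, also Σ z ηᵃ = 0. If p is a prime with p² ∣ N or p > 2k, averaging this over
-- the a ≡ 1 mod N/p shows that the terms with η^(N/p) = 1 form a vanishing
-- subsum. Hence one may pass from N to N/p until N divides the primorial
-- m of 2k. The remaining vanishing subsum contains ζ*ⱼ/ζ*ⱼ = 1, and it contains some
-- ζᵢ/ζ*ⱼ, for otherwise it would be a vanishing subsum of Σ c*ζ*; then (ζᵢ/ζ*ⱼ)ᵐ = 1.
--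
-- Conjugation does not use irreducibility of cyclotomic polynomials. The functions
-- f(b) = Σ z ηᵇ form a ring 𝓐. As powers of f are linearly dependent over ℤ, some
-- E ∈ 𝓐 is a nonzero integer d where f does not vanish, and 0 where it does. For a
-- prime q ∤ d, E(b)^q ≡ E(qb) modulo q𝓐, so E(b) and E(qb) are congruent; their
-- difference takes values in {0, ±d} only, and since sums of elements of 𝓐 over a
-- period are integers, the number of b where it is nonzero is divisible by arbitrarily
-- high powers of q. So f(b) = 0 implies f(qb) = 0, and a may be changed modulo N to be
-- prime to d.
--
-- All zero tests are decidable on 𝓐: an algebraic relation for f(b) with nonzero
-- constant term d splits, because ℂ is a local ring, into the case that f(b) is
-- cancellable and the case that a power of f(b) is 0.
module Submission where

open import Defs
open import Algebra.Bundles using (CommutativeRing)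
import Algebra.Morphism.Construct.Composition as Composition
open import Algebra.Morphism.Structures using (module RingMorphisms)
open import Data.Bool.Base using (Bool; true; false; if_then_else_; _∧_)
open import Data.Bool.Properties using (¬-not) renaming (_≟_ to _≟ᵇ_)
open import Data.Empty using (⊥; ⊥-elim)
open import Data.Fin.Base as Fin
  using (Fin; zero; suc; toℕ; fromℕ; fromℕ<; inject₁; punchIn; combine; remQuot; _↑ˡ_; _↑ʳ_)
open import Data.Fin.Properties as Fin
  using (any?; all?; pigeonhole; remQuot-combine; toℕ-fromℕ; toℕ-fromℕ<; toℕ-inject₁;
         toℕ-injective; toℕ<n)
open import Data.Fin.Subset using (Subset; Nonempty; _⊂_; ⊤; _∉_)
open import Data.Fin.Subset.Properties using (⊆⊤; ∈⊤)
open import Data.Integer.Base as ℤ using (ℤ; +_; -[1+_]; 0ℤ; 1ℤ; -1ℤ)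
import Data.Integer.Properties as ℤ
import Data.Integer.Tactic.RingSolver as ℤSolver
open import Data.List.Base using ([]; _∷_)
open import Data.List.Membership.Propositional.Properties using (∈-filter⁺; ∈-upTo⁺)
open import Data.List.Relation.Unary.All using (_∷_)
open import Data.Maybe.Base using (Maybe; just; nothing)
open import Data.Nat.Base as ℕ using (ℕ; zero; suc; _!)
open import Data.Nat.Combinatorics using (_C_; nCn≡1; nCk≡n!/k![n-k]!; k![n∸k]!∣n!)
open import Data.Nat.Coprimality as Coprimality using (Coprime; coprime-Bézout; prime⇒coprime)
open import Data.Nat.Divisibility
open import Data.Nat.DivMod using (_%_; _/_; m≡m%n+[m/n]*n; m%n<n; m/n*n≡m)
open import Data.Nat.GCD using (module Bézout)
open import Data.Nat.Induction using (<-rec)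
open import Data.Nat.ListAction using (product)
open import Data.Nat.ListAction.Properties using (∈⇒∣product)
open import Data.Nat.Primality
open import Data.Nat.Primality.Factorisation using (factorise)
import Data.Nat.Properties as ℕ
open import Data.Product.Base using (Σ; ∃-syntax; ∃₂; _×_; _,_; proj₁; proj₂)
open import Data.Rational.Base as ℚ using (ℚ; mkℚ; 0ℚ; 1ℚ; ½; ↥_; ↧_)
import Data.Rational.Properties as ℚ
import Data.Rational.Solver as ℚSolver
open import Data.Rational.Unnormalised.Base using (*≡*)
import Data.Rational.Unnormalised.Properties as ℚᵘ
open import Data.Sum.Base using (_⊎_; inj₁; inj₂; [_,_]′)
open import Data.Vec.Base using (tabulate)
open import Data.Vec.Functional using (_++_; insertAt)
open import Data.Vec.Functional.Properties
  using (lookup-++ˡ; lookup-++ʳ; insertAt-lookup; insertAt-punchIn)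
open import Data.Vec.Properties using (lookup∘tabulate; lookup⇒[]=; []=⇒lookup)
open import Function.Base using (_∘_; id)
import Level
import Relation.Binary.PropositionalEquality as ≡
open ≡ using (_≡_; _≢_)
open import Relation.Nullary.Decidable using (yes; no; ¬?; decidable-stable)
open import Relation.Nullary.Negation using (¬_; contradiction)

ℤ-ring = CommutativeRing.rawRing ℤ.+-*-commutativeRing
ℚ-ring = CommutativeRing.rawRing ℚ.+-*-commutativeRing

-- Prime numbers

prime-divisor : ∀ n → n ≢ 1 → n ≢ 0 → ∃[ p ] (Prime p × p ∣ n)
prime-divisor n n≢1 n≢0 with factorise n {{ℕ.≢-nonZero n≢0}}
... | record { factors = [] ; isFactorisation = eq } = contradiction eq n≢1
... | record { factors = p ∷ ps ; isFactorisation = eq ; factorsPrime = pp ∷ _ } =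
  p , pp , ∣-trans (m∣m*n (product ps)) (∣-reflexive (≡.sym eq))

prime∣prime⇒≡ : ∀ {p q} → Prime p → Prime q → p ∣ q → p ≡ q
prime∣prime⇒≡ pp pq p∣q with prime⇒irreducible pq p∣q
... | inj₁ ≡.refl = contradiction pp ¬prime[1]
... | inj₂ p≡q  = p≡q

prime∤1 : ∀ {p} → Prime p → p ∤ 1
prime∤1 pp p∣1 with ≡.refl ← ∣1⇒≡1 p∣1 = ¬prime[1] pp

prime-induction : ∀ {ℓ} (P : ℕ → Set ℓ) → P 1 →
                  (∀ p n → Prime p → n ≢ 0 → P n → P (p ℕ.* n)) →
                  ∀ n → n ≢ 0 → P n
prime-induction P P1 step = <-rec (λ n → n ≢ 0 → P n) go
  where
  go : ∀ n → (∀ {m} → m ℕ.< n → m ≢ 0 → P m) → n ≢ 0 → P n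
  go n rec n≢0 with n ℕ.≟ 1
  ... | yes ≡.refl = P1
  ... | no n≢1 with prime-divisor n n≢1 n≢0
  ...   | p , pp , divides m ≡.refl =
    ≡.subst P (ℕ.*-comm p m) (step p m pp m≢0 (rec m<n m≢0))
    where
    m≢0 : m ≢ 0
    m≢0 ≡.refl = n≢0 ≡.refl
    m<n : m ℕ.< m ℕ.* p
    m<n = ℕ.m<m*n m p {{ℕ.≢-nonZero m≢0}} (ℕ.nonTrivial⇒n>1 p {{prime⇒nonTrivial pp}})

prime∤⇒coprime : ∀ {p} → Prime p → ∀ {n} → p ∤ n → Coprime p n
prime∤⇒coprime pp p∤n (d∣p , d∣n) with prime⇒irreducible pp d∣p
... | inj₁ d≡1  = d≡1
... | inj₂ ≡.refl = contradiction d∣n p∤n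

prime∣primorial : ∀ {p n} → Prime p → p ℕ.≤ n → p ∣ primorial n
prime∣primorial pp p≤n = ∈⇒∣product (∈-filter⁺ prime? (∈-upTo⁺ (ℕ.s≤s p≤n)) pp)

coprime-*∣ : ∀ {m n o} → Coprime m n → m ∣ o → n ∣ o → m ℕ.* n ∣ o
coprime-*∣ {m} {n} c (divides q ≡.refl) n∣o =
  ≡.subst (m ℕ.* n ∣_) (ℕ.*-comm m q)
    (*-monoʳ-∣ m (Coprimality.coprime-divisor (Coprimality.sym c) (≡.subst (n ∣_) (ℕ.*-comm q m) n∣o)))

-- Built up one prime factor at a time. A new prime `p ≤ n` not dividing `M` is coprime to `M`, so
-- `p M` still divides the primorial; any other new prime is itself removable. A removable prime of
-- `M` stays removable in `p M`.
∣primorial-or-removable-prime : ∀ n N → N ≢ 0 →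
  N ∣ primorial n ⊎
  ∃₂ λ p M → Prime p × N ≡ p ℕ.* M × (p ∣ M ⊎ n ℕ.< p)
∣primorial-or-removable-prime n = prime-induction _ (inj₁ (1∣ _)) step
  where
  P = λ N → N ∣ primorial n ⊎ ∃₂ λ p M → Prime p × N ≡ p ℕ.* M × (p ∣ M ⊎ n ℕ.< p)
  step : ∀ p M → Prime p → M ≢ 0 → P M → P (p ℕ.* M)
  step p M pp _ ih with p ∣? M | n ℕ.<? p
  ... | yes p∣M | _       = inj₂ (p , M , pp , ≡.refl , inj₁ p∣M)
  ... | no _    | yes n<p = inj₂ (p , M , pp , ≡.refl , inj₂ n<p)
  ... | no p∤M  | no n≮p with ih
  ...   | inj₁ M∣ = inj₁ (coprime-*∣ (prime∤⇒coprime pp p∤M)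
                            (prime∣primorial pp (ℕ.≮⇒≥ n≮p)) M∣)
  ...   | inj₂ (p′ , M′ , pp′ , ≡.refl , bad) =
    inj₂ (p′ , p ℕ.* M′ , pp′ , swap , [ inj₁ ∘ ∣n⇒∣m*n p , inj₂ ]′ bad)
    where
    swap : p ℕ.* (p′ ℕ.* M′) ≡ p′ ℕ.* (p ℕ.* M′)
    swap = ≡.trans (≡.sym (ℕ.*-assoc p p′ M′)) (≡.trans (≡.cong (ℕ._* M′) (ℕ.*-comm p p′)) (ℕ.*-assoc p′ p M′))

-- Coprimality spelled out prime by prime, because conjugation is carried out one prime factor of
-- the exponent at a time.
NoCommonPrime : ℕ → ℕ → Set
NoCommonPrime m n = ∀ {q} → Prime q → q ∣ m → q ∤ n

-- Changing `t` by `D` moves `a + N t` by `N D`, which no prime divisor of `D` can see. If the new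
-- prime `p` divides `a + N t`, it divides neither `D`, by the induction hypothesis, nor `N`, else
-- it would divide `a`; so this move destroys divisibility by `p`.
shift-avoiding : ∀ {a N} → NoCommonPrime a N → ∀ D → D ≢ 0 →
                 ∃[ t ] NoCommonPrime (a ℕ.+ N ℕ.* t) D
shift-avoiding {a} {N} a⊥N = prime-induction _ (0 , λ pq _ → prime∤1 pq) step
  where
  step : ∀ p D → Prime p → D ≢ 0 → (∃[ t ] NoCommonPrime (a ℕ.+ N ℕ.* t) D) →
         ∃[ t ] NoCommonPrime (a ℕ.+ N ℕ.* t) (p ℕ.* D)
  step p D pp _ (t , h) with p ∣? a ℕ.+ N ℕ.* t
  ... | no p∤ = t , λ {q} pq q∣ q∣pD → case (euclidsLemma p D pq q∣pD) pq q∣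
    where
    case : ∀ {q} → q ∣ p ⊎ q ∣ D → Prime q → q ∤ a ℕ.+ N ℕ.* t
    case (inj₁ q∣p) pq q∣ = p∤ (≡.subst (_∣ _) (prime∣prime⇒≡ pq pp q∣p) q∣)
    case (inj₂ q∣D) pq q∣ = h pq q∣ q∣D
  ... | yes p∣ = t ℕ.+ D , λ {q} pq q∣ q∣pD → case (euclidsLemma p D pq q∣pD) pq q∣
    where
    eq : a ℕ.+ N ℕ.* (t ℕ.+ D) ≡ (a ℕ.+ N ℕ.* t) ℕ.+ N ℕ.* D
    eq = ≡.trans (≡.cong (a ℕ.+_) (ℕ.*-distribˡ-+ N t D)) (≡.sym (ℕ.+-assoc a _ _))
    case : ∀ {q} → q ∣ p ⊎ q ∣ D → Prime q → q ∤ a ℕ.+ N ℕ.* (t ℕ.+ D)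
    case {q} (inj₁ q∣p) pq q∣ with ≡.refl ← prime∣prime⇒≡ pq pp q∣p
      with euclidsLemma N D pq (∣m+n∣m⇒∣n (≡.subst (q ∣_) eq q∣) p∣)
    ... | inj₁ q∣N = a⊥N pq (∣m+n∣n⇒∣m p∣ (∣m⇒∣m*n t q∣N)) q∣N
      where ∣m+n∣n⇒∣m : ∀ {m n} → q ∣ m ℕ.+ n → q ∣ n → q ∣ m
            ∣m+n∣n⇒∣m {m} {n} x y = ∣m+n∣m⇒∣n (≡.subst (q ∣_) (ℕ.+-comm m n) x) y
    ... | inj₂ q∣D = h pq p∣ q∣D
    case {q} (inj₂ q∣D) pq q∣ =
      h pq (∣m+n∣m⇒∣n (≡.subst (q ∣_) (≡.trans eq (ℕ.+-comm (a ℕ.+ N ℕ.* t) _)) q∣) (∣n⇒∣m*n N q∣D)) q∣D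

prime-power∣⇒∣ : ∀ {p D} → Prime p → p ∤ D → ∀ m {c} → p ℕ.^ m ∣ D ℕ.* c → p ℕ.^ m ∣ c
prime-power∣⇒∣ pp p∤D zero h = 1∣ _
prime-power∣⇒∣ {p} {D} pp p∤D (suc m) {c} h
  with euclidsLemma D c pp (m*n∣⇒m∣ p (p ℕ.^ m) h)
... | inj₁ p∣D = contradiction p∣D p∤D
... | inj₂ (divides c′ ≡.refl) =
  ≡.subst (p ℕ.^ suc m ∣_) (ℕ.*-comm p c′)
    (*-monoʳ-∣ p (prime-power∣⇒∣ pp p∤D m (*-cancelˡ-∣ p {{prime⇒nonZero pp}}
      (≡.subst (p ℕ.* p ℕ.^ m ∣_) eq h))))
  where
  eq : D ℕ.* (c′ ℕ.* p) ≡ p ℕ.* (D ℕ.* c′)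
  eq = ≡.trans (≡.sym (ℕ.*-assoc D c′ p)) (ℕ.*-comm (D ℕ.* c′) p)

n<2^n : ∀ n → n ℕ.< 2 ℕ.^ n
n<2^n zero = ℕ.s≤s ℕ.z≤n
n<2^n (suc n) = begin-strict
  suc n                  <⟨ ℕ.s≤s (n<2^n n) ⟩
  suc (2 ℕ.^ n)          ≤⟨ ℕ.+-monoˡ-≤ _ (ℕ.m^n>0 2 n) ⟩
  2 ℕ.^ n ℕ.+ 2 ℕ.^ n    ≡⟨ ≡.cong (2 ℕ.^ n ℕ.+_) (ℕ.+-identityʳ _) ⟨
  2 ℕ.^ suc n            ∎
  where open ℕ.≤-Reasoning

-- The chain `p^m ≥ 2^m > m ≥ c` leaves no room for a nonzero `c`. In the application `c` counts
-- residues modulo `m`, whence the bound `m`.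
large-prime-power∣⇒≡0 : ∀ {p c} → Prime p → ∀ m → c ℕ.≤ m → p ℕ.^ m ∣ c → c ≡ 0
large-prime-power∣⇒≡0 {p} {zero} pp m c≤m h = ≡.refl
large-prime-power∣⇒≡0 {p} {suc c} pp m c≤m h = contradiction (begin-strict
  p ℕ.^ m  ≤⟨ ∣⇒≤ h ⟩
  suc c    ≤⟨ c≤m ⟩
  m        <⟨ n<2^n m ⟩
  2 ℕ.^ m  ≤⟨ ℕ.^-monoˡ-≤ m (ℕ.nonTrivial⇒n>1 p {{prime⇒nonTrivial pp}}) ⟩
  p ℕ.^ m  ∎) (ℕ.<-irrefl ≡.refl)
  where open ℕ.≤-Reasoning

prime∤! : ∀ {p} → Prime p → ∀ k → k ℕ.< p → p ∤ k !
prime∤! pp zero    _   = prime∤1 pp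
prime∤! pp (suc k) k<p p∣ with euclidsLemma (suc k) (k !) pp p∣
... | inj₁ p∣sk = ℕ.<⇒≱ k<p (∣⇒≤ p∣sk)
... | inj₂ p∣k! = prime∤! pp k (ℕ.<-trans (ℕ.n<1+n k) k<p) p∣k!

prime∣C : ∀ {p k} → Prime p → 0 ℕ.< k → k ℕ.< p → p ∣ p C k
prime∣C {p} {k} pp 0<k k<p with euclidsLemma (p C k) (k ! ℕ.* (p ℕ.∸ k) !) pp p∣prod
  where
  instance
    nz = ℕ.m*n≢0 (k !) ((p ℕ.∸ k) !) {{k ℕ.!≢0}} {{(p ℕ.∸ k) ℕ.!≢0}}
  p∣p! : ∀ {p} → Prime p → p ∣ p !
  p∣p! {zero}  pp = contradiction pp ¬prime[0]
  p∣p! {suc p} pp = m∣m*n (p !)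
  p∣prod : p ∣ (p C k) ℕ.* (k ! ℕ.* (p ℕ.∸ k) !)
  p∣prod = ≡.subst (p ∣_)
    (≡.sym (≡.trans (≡.cong (ℕ._* (k ! ℕ.* (p ℕ.∸ k) !)) (nCk≡n!/k![n-k]! (ℕ.<⇒≤ k<p)))
                    (m/n*n≡m (k![n∸k]!∣n! (ℕ.<⇒≤ k<p)))))
    (p∣p! pp)
... | inj₁ p∣C = p∣C
... | inj₂ p∣kk with euclidsLemma (k !) ((p ℕ.∸ k) !) pp p∣kk
...   | inj₁ h = contradiction h (prime∤! pp k k<p)
...   | inj₂ h = contradiction h (prime∤! pp (p ℕ.∸ k) (ℕ.∸-monoʳ-< 0<k (ℕ.<⇒≤ k<p)))

module ℕΣ where
  open import Algebra.Properties.Semiring.Sum ℕ.+-*-semiring public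

sum-≤1 : ∀ {n} (f : Fin n → ℕ) → (∀ i → f i ℕ.≤ 1) → ℕΣ.sum f ℕ.≤ n
sum-≤1 {zero}  f h = ℕ.z≤n
sum-≤1 {suc n} f h = ℕ.+-mono-≤ (h zero) (sum-≤1 (f ∘ suc) (h ∘ suc))

sum≡0⇒≡0 : ∀ {n} (f : Fin n → ℕ) → ℕΣ.sum f ≡ 0 → ∀ i → f i ≡ 0
sum≡0⇒≡0 f h zero    = ℕ.m+n≡0⇒m≡0 (f zero) h
sum≡0⇒≡0 f h (suc i) = sum≡0⇒≡0 (f ∘ suc) (ℕ.m+n≡0⇒n≡0 (f zero) h) i

prime∤^ : ∀ {p m} → Prime p → p ∤ m → ∀ n → p ∤ m ℕ.^ n
prime∤^ pp p∤m zero    = prime∤1 pp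
prime∤^ {p} {m} pp p∤m (suc n) h with euclidsLemma m (m ℕ.^ n) pp h
... | inj₁ p∣m = p∤m p∣m
... | inj₂ h′  = prime∤^ pp p∤m n h′

^-monoˡ-∣ : ∀ {m n} k → m ∣ n → m ℕ.^ k ∣ n ℕ.^ k
^-monoˡ-∣ zero    m∣n = ∣-refl
^-monoˡ-∣ (suc k) m∣n = *-pres-∣ m∣n (^-monoˡ-∣ k m∣n)

i*i≡∣i∣*∣i∣ : ∀ i → i ℤ.* i ≡ + (ℤ.∣ i ∣ ℕ.* ℤ.∣ i ∣)
i*i≡∣i∣*∣i∣ (+ n)    = ≡.sym (ℤ.pos-* n n)
i*i≡∣i∣*∣i∣ -[1+ n ] = ≡.refl

-- Integral relations

module ℤΣ where
  open import Algebra.Properties.Semiring.Sum (CommutativeRing.semiring ℤ.+-*-commutativeRing) public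

module _ where
  open ℤΣ using (sum)
  open ℤSolver using (solve-∀)
  open import Data.Integer.Base using (_*_; _-_; -_; _+_)

  private
    elim : ∀ a y w w₀ v → y * (a * w - w₀ * v) ≡ - (y * w₀) * v + (a * y) * w
    elim = solve-∀
    neg-*  : ∀ x v → - x * v ≡ - (x * v)
    neg-* = solve-∀
    cancel : ∀ a y w v → y * (a * w - w * a) ≡ 0ℤ
    cancel = solve-∀

  -- Fraction-free Gaussian elimination. If column `zero` vanishes, it is dropped together with the
  -- first vector, which gets coefficient 0. Otherwise a pivot row `i` clears this column from the
  -- other rows, and a relation among the results is lifted back.
  linear-dependence : ∀ s (v : Fin (suc s) → Fin s → ℤ) →
    Σ (Fin (suc s) → ℤ) λ x → (Σ (Fin (suc s)) λ i → x i ≢ 0ℤ) × (∀ j → sum (λ i → x i * v i j) ≡ 0ℤ)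
  linear-dependence zero v = (λ _ → 1ℤ) , (zero , λ ()) , λ ()
  linear-dependence (suc s) v with any? (λ i → ¬? (v i zero ℤ.≟ 0ℤ))
  ... | no none with linear-dependence s (λ i j → v (suc i) (suc j))
  ...   | x , (i₀ , x≢0) , rel = x′ , (suc i₀ , x≢0) , rel′
    where
    x′ : Fin (suc (suc s)) → ℤ
    x′ zero    = 0ℤ
    x′ (suc i) = x i
    col₀ : ∀ i → v i zero ≡ 0ℤ
    col₀ i = decidable-stable (_ ℤ.≟ _) (λ h → none (i , h))
    rel′ : ∀ j → sum (λ i → x′ i * v i j) ≡ 0ℤ
    rel′ zero    = ≡.trans (ℤΣ.sum-cong-≗ λ i → ≡.trans (≡.cong (x′ i *_) (col₀ i)) (ℤ.*-zeroʳ (x′ i)))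
                         (ℤΣ.sum-replicate-zero (suc (suc s)))
    rel′ (suc j) = ≡.trans (ℤ.+-identityˡ _) (rel j)
  linear-dependence (suc s) v | yes (i , a≢0)
    with linear-dependence s (λ k j → v i zero * v (punchIn i k) (suc j) - v (punchIn i k) zero * v i (suc j))
  ...   | y , (k₀ , y≢0) , rel = x , (punchIn i k₀ , x≢0) , rel′
    where
    a = v i zero
    w = λ k → v (punchIn i k)
    -- Expanding `Σ y k (a w k - w k zero v i)` forces the coefficients `xᵢ` and `a y k`; in column
    -- `zero` each bracket is 0 anyway.
    xᵢ = sum (λ k → - (y k * w k zero))
    x = insertAt (λ k → a * y k) i xᵢ
    x≢0 : x (punchIn i k₀) ≢ 0ℤ
    x≢0 eq with ℤ.i*j≡0⇒i≡0∨j≡0 a (≡.trans (≡.sym (insertAt-punchIn (λ k → a * y k) i xᵢ k₀)) eq)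
    ... | inj₁ h = a≢0 h
    ... | inj₂ h = y≢0 h
    elim-all : ∀ j → sum (λ k → y k * (a * w k j - w k zero * v i j)) ≡ 0ℤ
    elim-all zero    = ≡.trans (ℤΣ.sum-cong-≗ λ k → cancel a (y k) (w k zero) a) (ℤΣ.sum-replicate-zero (suc s))
    elim-all (suc j) = rel j
    open ≡.≡-Reasoning
    rel′ : ∀ j → sum (λ l → x l * v l j) ≡ 0ℤ
    rel′ j = begin
      sum (λ l → x l * v l j)
        ≡⟨ ℤΣ.sum-remove {i = i} (λ l → x l * v l j) ⟩
      x i * v i j + sum (λ k → x (punchIn i k) * w k j)
        ≡⟨ ≡.cong₂ _+_ (≡.cong (_* v i j) (insertAt-lookup (λ k → a * y k) i xᵢ))
             (ℤΣ.sum-cong-≗ λ k → ≡.cong (_* w k j) (insertAt-punchIn (λ k → a * y k) i xᵢ k)) ⟩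
      xᵢ * v i j + sum (λ k → a * y k * w k j)
        ≡⟨ ≡.cong (_+ sum (λ k → a * y k * w k j)) (ℤΣ.*-distribʳ-sum (v i j) (λ k → - (y k * w k zero))) ⟩
      sum (λ k → - (y k * w k zero) * v i j) + sum (λ k → a * y k * w k j)
        ≡⟨ ℤΣ.∑-distrib-+ (λ k → - (y k * w k zero) * v i j) (λ k → a * y k * w k j) ⟨
      sum (λ k → - (y k * w k zero) * v i j + a * y k * w k j)
        ≡⟨ ℤΣ.sum-cong-≗ (λ k → elim a (y k) (w k j) (w k zero) (v i j)) ⟨
      sum (λ k → y k * (a * w k j - w k zero * v i j))
        ≡⟨ elim-all j ⟩
      0ℤ ∎

-- The ring of exponential sums

module RingSum {c ℓ} (R : CommutativeRing c ℓ) where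
  open CommutativeRing R public hiding (zero)
  open import Algebra.Properties.Semiring.Sum semiring public
  open import Algebra.Properties.Semiring.Mult semiring public using () renaming (_×_ to _·_)
  open import Algebra.Properties.CommutativeSemiring.Exp commutativeSemiring public
  open import Algebra.Properties.Ring ring public using (-‿distribˡ-*; -0#≈0#; x∙y⁻¹≈ε⇒x≈y; x≈y⇒x∙y⁻¹≈ε)
  open import Algebra.Solver.Ring.AlmostCommutativeRing public
    using (AlmostCommutativeRing; fromCommutativeRing; _-Raw-AlmostCommutative⟶_)
  open import Relation.Binary.Reasoning.Setoid setoid public

  acr : AlmostCommutativeRing c ℓ
  acr = fromCommutativeRing R

  Regular : Carrier → Set (c Level.⊔ ℓ)
  Regular x = ∀ y → x * y ≈ 0# → y ≈ 0#

  -- `Local` is the local-ring condition with "cancellable" in place of "invertible". Combined with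
  -- an algebraic equation it takes the place of a zero test.
  Nontrivial Reduced Local : Set _
  Nontrivial = ¬ 1# ≈ 0#
  Reduced = ∀ x → x * x ≈ 0# → x ≈ 0#
  Local = ∀ x → Regular x ⊎ Regular (1# - x)

  1^n≈1 : ∀ n → 1# ^ n ≈ 1#
  1^n≈1 zero    = refl
  1^n≈1 (suc n) = trans (*-identityˡ _) (1^n≈1 n)

  0^suc≈0 : ∀ {x} n → x ≈ 0# → x ^ suc n ≈ 0#
  0^suc≈0 n x≈0 = trans (*-congʳ x≈0) (zeroˡ _)

  sum-≈0 : ∀ {n} {f : Fin n → Carrier} → (∀ i → f i ≈ 0#) → sum f ≈ 0#
  sum-≈0 {n} f≈0 = trans (sum-cong-≋ f≈0) (sum-replicate-zero n)

  power-torsion : ∀ x n → x ^ n ≈ 1# → ∀ t → x ^ (n ℕ.* t) ≈ 1#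
  power-torsion x n h t = trans (sym (^-assocʳ x n t)) (trans (^-congˡ t h) (1^n≈1 t))

module Integers {c ℓ} (R : CommutativeRing c ℓ)
  (ι : ℤ → CommutativeRing.Carrier R)
  (ι-hom : RingMorphisms.IsRingHomomorphism ℤ-ring (CommutativeRing.rawRing R) ι)
  where
  open RingSum R
  open RingMorphisms.IsRingHomomorphism ι-hom public
    renaming (+-homo to ι-+; *-homo to ι-*; -‿homo to ι-neg; 0#-homo to ι-0; 1#-homo to ι-1; ⟦⟧-cong to ι-cong)

  ι-morphism : ℤ-ring -Raw-AlmostCommutative⟶ acr
  ι-morphism = record { ⟦_⟧ = ι ; +-homo = ι-+ ; *-homo = ι-* ; -‿homo = ι-neg ; 0-homo = ι-0 ; 1-homo = ι-1 }

  ι-≟ : ∀ m n → Maybe (ι m ≈ ι n)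
  ι-≟ m n with m ℤ.≟ n
  ... | yes ≡.refl = just refl
  ... | no _       = nothing

  module Solver where
    open import Algebra.Solver.Ring ℤ-ring acr ι-morphism ι-≟ public
  open Solver using (solve; _:+_; _:*_; _:-_; :-_; _:=_)

  geom-step : ∀ w x u S → w * (u + x * S) ≈ w * u + x * (w * S)
  geom-step = solve 4 (λ w x u S → w :* (u :+ x :* S) := w :* u :+ x :* (w :* S)) refl

  telescope : ∀ x y u v → x * u - v + x * (y - u) ≈ x * y - v
  telescope = solve 4 (λ x y u v → x :* u :- v :+ x :* (y :- u) := x :* y :- v) refl

  geometric-sum : ∀ x n → (x - 1#) * sum {n} (λ b → x ^ toℕ b) ≈ x ^ n - 1#
  geometric-sum x zero    = trans (zeroʳ _) (sym (-‿inverseʳ 1#))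
  geometric-sum x (suc n) = begin
    (x - 1#) * (1# + sum {n} (λ b → x * x ^ toℕ b))
      ≈⟨ *-congˡ (+-congˡ (*-distribˡ-sum {n} x (λ b → x ^ toℕ b))) ⟨
    (x - 1#) * (1# + x * sum {n} (λ b → x ^ toℕ b))
      ≈⟨ trans (geom-step (x - 1#) x 1# _) (+-congʳ (*-identityʳ (x - 1#))) ⟩
    x - 1# + x * ((x - 1#) * sum {n} (λ b → x ^ toℕ b))
      ≈⟨ +-congˡ (*-congˡ (geometric-sum x n)) ⟩
    x - 1# + x * (x ^ n - 1#)
      ≈⟨ trans (+-congʳ (+-congʳ (sym (*-identityʳ x)))) (telescope x (x ^ n) 1# 1#) ⟩
    x * x ^ n - 1# ∎

  ι-sum : ∀ {n} (f : Fin n → ℤ) → ι (ℤΣ.sum f) ≈ sum (λ i → ι (f i))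
  ι-sum {zero}  f = ι-0
  ι-sum {suc n} f = trans (ι-+ _ _) (+-congˡ (ι-sum (λ i → f (suc i))))

  ν : ℕ → Carrier
  ν n = ι (+ n)

  ν-* : ∀ m n → ν (m ℕ.* n) ≈ ν m * ν n
  ν-* m n = trans (ι-cong (ℤ.pos-* m n)) (ι-* (+ m) (+ n))

  ν-^ : ∀ m n → ν (m ℕ.^ n) ≈ ν m ^ n
  ν-^ m zero    = ι-1
  ν-^ m (suc n) = trans (ν-* m (m ℕ.^ n)) (*-congˡ (ν-^ m n))

  InvertibleIntegers : Set _
  InvertibleIntegers = ∀ n → n ≢ 0ℤ → Σ Carrier λ r → ι n * r ≈ 1#

  ·≈ν* : ∀ n x → n · x ≈ ν n * x
  ·≈ν* zero    x = sym (trans (*-congʳ ι-0) (zeroˡ x))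
  ·≈ν* (suc n) x = begin
    x + n · x         ≈⟨ +-cong (sym (*-identityˡ x)) (·≈ν* n x) ⟩
    1# * x + ν n * x  ≈⟨ distribʳ x 1# (ν n) ⟨
    (1# + ν n) * x    ≈⟨ *-congʳ (+-congʳ ι-1) ⟨
    (ν 1 + ν n) * x   ≈⟨ *-congʳ (ι-+ (+ 1) (+ n)) ⟨
    ν (suc n) * x     ∎

  -- Integral combinations of the exponentials b ↦ μₗᵇ: a concrete model of the
  -- integral group ring of the group {μₗ}, with pointwise operations.
  module _ {s : ℕ} (μ : Fin s → Carrier) where
    record Span (f : ℕ → Carrier) : Set ℓ where
      constructor mkSpan
      field
        coeff  : Fin s → ℤ
        expand : ∀ b → f b ≈ sum (λ l → ι (coeff l) * μ l ^ b)
    open Span public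

  module SpanProperties {s : ℕ} (μ : Fin s → Carrier)
    (μ-one : Σ (Fin s) λ l → μ l ≈ 1#)
    (μ-mul : ∀ i j → Σ (Fin s) λ l → μ i * μ j ≈ μ l) where

    span-cong : ∀ {f g} → (∀ b → f b ≈ g b) → Span μ f → Span μ g
    span-cong f≈g (mkSpan z e) = mkSpan z λ b → trans (sym (f≈g b)) (e b)

    span-0 : Span μ (λ _ → 0#)
    span-0 = mkSpan (λ _ → 0ℤ) λ b → sym (sum-≈0 {s} λ l → trans (*-congʳ ι-0) (zeroˡ _))

    span-+ : ∀ {f g} → Span μ f → Span μ g → Span μ (λ b → f b + g b)
    span-+ {f} {g} (mkSpan z e) (mkSpan w e′) = mkSpan (λ l → z l ℤ.+ w l) λ b → begin
      f b + g b
        ≈⟨ +-cong (e b) (e′ b) ⟩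
      sum (λ l → ι (z l) * μ l ^ b) + sum (λ l → ι (w l) * μ l ^ b)
        ≈⟨ ∑-distrib-+ {s} _ _ ⟨
      sum (λ l → ι (z l) * μ l ^ b + ι (w l) * μ l ^ b)
        ≈⟨ sum-cong-≋ {s} (λ l → trans (*-congʳ (ι-+ (z l) (w l))) (distribʳ _ _ _)) ⟨
      sum (λ l → ι (z l ℤ.+ w l) * μ l ^ b) ∎

    span-scale : ∀ n {f} → Span μ f → Span μ (λ b → ι n * f b)
    span-scale n {f} (mkSpan z e) = mkSpan (λ l → n ℤ.* z l) λ b → begin
      ι n * f b
        ≈⟨ *-congˡ (e b) ⟩
      ι n * sum (λ l → ι (z l) * μ l ^ b)
        ≈⟨ *-distribˡ-sum {s} _ _ ⟩
      sum (λ l → ι n * (ι (z l) * μ l ^ b))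
        ≈⟨ sum-cong-≋ {s} (λ l → trans (*-congʳ (ι-* n (z l))) (*-assoc _ _ _)) ⟨
      sum (λ l → ι (n ℤ.* z l) * μ l ^ b) ∎

    span-neg : ∀ {f} → Span μ f → Span μ (λ b → - f b)
    span-neg sf = span-cong
      (λ b → trans (*-congʳ (trans (ι-neg 1ℤ) (-‿cong ι-1)))
               (trans (sym (-‿distribˡ-* 1# _)) (-‿cong (*-identityˡ _))))
      (span-scale -1ℤ sf)

    private
      δ : ∀ {n} → Fin n → Fin n → ℤ
      δ zero    zero    = 1ℤ
      δ zero    (suc _) = 0ℤ
      δ (suc _) zero    = 0ℤ
      δ (suc i) (suc j) = δ i j

      sum-δ : ∀ {n} (i : Fin n) (x : Fin n → Carrier) → sum (λ l → ι (δ i l) * x l) ≈ x i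
      sum-δ {suc n} zero    x = trans (+-cong (trans (*-congʳ ι-1) (*-identityˡ _))
        (sum-≈0 {n} λ l → trans (*-congʳ ι-0) (zeroˡ _))) (+-identityʳ _)
      sum-δ (suc i) x = trans (+-cong (trans (*-congʳ ι-0) (zeroˡ _)) (sum-δ i (λ l → x (suc l)))) (+-identityˡ _)

    span-μ : ∀ l → Span μ (μ l ^_)
    span-μ l = mkSpan (δ l) λ b → sym (sum-δ l (λ j → μ j ^ b))

    span-1 : Span μ (λ _ → 1#)
    span-1 = span-cong (λ b → trans (^-congˡ b (proj₂ μ-one)) (1^n≈1 b)) (span-μ (proj₁ μ-one))

    span-const : ∀ n → Span μ (λ _ → ι n)
    span-const n = span-cong (λ _ → *-identityʳ _) (span-scale n span-1)

    span-sum : ∀ {n} {f : Fin n → ℕ → Carrier} → (∀ i → Span μ (f i)) → Span μ (λ b → sum (λ i → f i b))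
    span-sum {zero}  sf = span-0
    span-sum {suc n} sf = span-+ (sf zero) (span-sum (λ i → sf (suc i)))

    span-* : ∀ {f g} → Span μ f → Span μ g → Span μ (λ b → f b * g b)
    span-* {f} {g} (mkSpan z e) sg@(mkSpan w e′) =
      span-cong eq (span-sum {s} λ i → span-scale (z i) (span-sum {s} λ j → span-scale (w j) (span-μ² i j)))
      where
      span-μ² : ∀ i j → Span μ (λ b → μ i ^ b * μ j ^ b)
      span-μ² i j = let l , h = μ-mul i j in
        span-cong (λ b → trans (^-congˡ b (sym h)) (^-distrib-* (μ i) (μ j) b)) (span-μ l)
      eq : ∀ b → sum (λ i → ι (z i) * sum (λ j → ι (w j) * (μ i ^ b * μ j ^ b))) ≈ f b * g b
      eq b = begin
        sum (λ i → ι (z i) * sum (λ j → ι (w j) * (μ i ^ b * μ j ^ b)))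
          ≈⟨ sum-cong-≋ {s} (λ i → *-congˡ (sum-cong-≋ {s} λ j →
               trans (sym (*-assoc _ _ _)) (trans (*-congʳ (*-comm _ _)) (*-assoc _ _ _)))) ⟩
        sum (λ i → ι (z i) * sum (λ j → μ i ^ b * (ι (w j) * μ j ^ b)))
          ≈⟨ sum-cong-≋ {s} (λ i → *-congˡ (*-distribˡ-sum {s} _ _)) ⟨
        sum (λ i → ι (z i) * (μ i ^ b * sum (λ j → ι (w j) * μ j ^ b)))
          ≈⟨ sum-cong-≋ {s} (λ i → trans (*-assoc _ _ _) (*-congˡ (*-congˡ (e′ b)))) ⟨
        sum (λ i → ι (z i) * μ i ^ b * g b)
          ≈⟨ *-distribʳ-sum {s} _ _ ⟨
        sum (λ i → ι (z i) * μ i ^ b) * g b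
          ≈⟨ *-congʳ (e b) ⟨
        f b * g b ∎

    span-^ : ∀ {f} → Span μ f → ∀ n → Span μ (λ b → f b ^ n)
    span-^ sf zero    = span-1
    span-^ sf (suc n) = span-* sf (span-^ sf n)

    span-periodic : ∀ N {f} → (∀ l → μ l ^ N ≈ 1#) → Span μ f → ∀ a t → f (a ℕ.+ N ℕ.* t) ≈ f a
    span-periodic N {f} torsion (mkSpan z e) a t = trans (e _) (trans
      (sum-cong-≋ {s} λ l → *-congˡ (trans (^-homo-* (μ l) a (N ℕ.* t))
        (trans (*-congˡ (power-torsion (μ l) N (torsion l) t)) (*-identityʳ _))))
      (sym (e a)))

  -- Frobenius congruences for exponential sums.

  import Algebra.Properties.CommutativeSemiring.Binomial commutativeSemiring as Binomial

  private
    cross : ∀ m → Prime (suc (suc m)) → (k : Fin (suc m)) →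
            ∃[ w ] suc (suc m) C suc (toℕ k) ≡ suc (suc m) ℕ.* w
    cross m pp k with prime∣C pp (ℕ.s≤s ℕ.z≤n) (ℕ.s≤s (toℕ<n k))
    ... | divides w eq = w , ≡.trans eq (ℕ.*-comm w _)

  -- An explicit quotient of `(x + y)^q - x^q - y^q` by `q = m + 2`. Its coefficients are integers,
  -- so it stays in the span when `x` and `y` do. The index `k` stands for the binomial index
  -- `k + 1`, which leaves out both end terms.
  frobenius-remainder : ∀ m → Prime (suc (suc m)) → Carrier → Carrier → Carrier
  frobenius-remainder m pp x y =
    sum {suc m} λ k → ν (proj₁ (cross m pp k)) * (x ^ suc (toℕ k) * y ^ (suc m ℕ.∸ toℕ k))

  private
    rearrange : ∀ a b c → a + (b + c) ≈ c + a + b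
    rearrange = solve 3 (λ a b c → a :+ (b :+ c) := c :+ a :+ b) refl

  frobenius-+ : ∀ m (pp : Prime (suc (suc m))) x y →
    (x + y) ^ suc (suc m) ≈ x ^ suc (suc m) + y ^ suc (suc m) + ν (suc (suc m)) * frobenius-remainder m pp x y
  frobenius-+ m pp x y = begin
    (x + y) ^ q
      ≈⟨ Binomial.theorem q x y ⟩
    term zero + sum (λ k → term (suc k))
      ≈⟨ +-cong first (sum-init-last {suc m} (λ k → term (suc k))) ⟩
    y ^ q + (sum {suc m} (λ k → term (suc (inject₁ k))) + term (suc (fromℕ (suc m))))
      ≈⟨ +-congˡ (+-cong (sum-cong-≋ {suc m} middle) last-term) ⟩
    y ^ q + (sum {suc m} (λ k → ν q * rem k) + x ^ q)
      ≈⟨ +-congˡ (+-congʳ (*-distribˡ-sum {suc m} (ν q) rem)) ⟨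
    y ^ q + (ν q * sum {suc m} rem + x ^ q)
      ≈⟨ rearrange _ _ _ ⟩
    x ^ q + y ^ q + ν q * sum {suc m} rem ∎
    where
    q = suc (suc m)
    term = λ (k : Fin (suc q)) → (q C toℕ k) · (x ^ toℕ k * y ^ (q ℕ.∸ toℕ k))
    rem = λ (k : Fin (suc m)) → ν (proj₁ (cross m pp k)) * (x ^ suc (toℕ k) * y ^ (suc m ℕ.∸ toℕ k))
    first : term zero ≈ y ^ q
    first = trans (+-identityʳ _) (*-identityˡ _)
    middle : ∀ k → term (suc (inject₁ k)) ≈ ν q * rem k
    middle k rewrite toℕ-inject₁ k = trans (·≈ν* _ _)
      (trans (*-congʳ (trans (ι-cong (≡.cong +_ (proj₂ (cross m pp k)))) (ν-* q _))) (*-assoc _ _ _))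
    last-term : term (suc (fromℕ (suc m))) ≈ x ^ q
    last-term rewrite toℕ-fromℕ m | nCn≡1 q | ℕ.n∸n≡0 m =
      trans (+-identityʳ _) (*-identityʳ _)

  module _ {s : ℕ} (μ : Fin s → Carrier)
    (μ-one : Σ (Fin s) λ l → μ l ≈ 1#)
    (μ-mul : ∀ i j → Σ (Fin s) λ l → μ i * μ j ≈ μ l)
    {q : ℕ} (q-prime : Prime q) where
    open SpanProperties μ μ-one μ-mul

    -- The congruence of `f(b)^q` and `f(q b)` modulo `q`. The remainder has to lie in the span:
    -- where `q` is invertible in the ring, as in the application, a remainder merely in the ring
    -- would always exist.
    record FrobeniusLift (f : ℕ → Carrier) : Set (c Level.⊔ ℓ) where
      constructor mkLift
      field
        inSpan    : Span μ f
        remainder : ℕ → Carrier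
        remainder-inSpan : Span μ remainder
        lift      : ∀ b → f b ^ q ≈ f (q ℕ.* b) + ν q * remainder b

    private
      collect : ∀ a b c d e n → a + n * b + (c + n * d) + n * e ≈ a + c + n * (b + d + e)
      collect = solve 6 (λ a b c d e n →
        a :+ n :* b :+ (c :+ n :* d) :+ n :* e := a :+ c :+ n :* (b :+ d :+ e)) refl

      solve-y : ∀ x y a b n m → y ≈ (x + y + n * m) - (x - (a + n * b)) - (a + n * (b + m))
      solve-y = solve 6 (λ x y a b n m →
        y := (x :+ y :+ n :* m) :- (x :- (a :+ n :* b)) :- (a :+ n :* (b :+ m))) refl

      simplify-neg : ∀ x → 0# - 0# - x ≈ - x
      simplify-neg x = trans (+-congʳ (-‿inverseʳ 0#)) (+-identityˡ (- x))

      neg-form : ∀ a n r → - (a + n * r) ≈ - a + n * - r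
      neg-form = solve 3 (λ a n r → :- (a :+ n :* r) := :- a :+ n :* :- r) refl

      suc² : ∀ {n} → Prime n → ∃[ m ] n ≡ suc (suc m)
      suc² {zero}        pp = contradiction pp ¬prime[0]
      suc² {suc zero}    pp = contradiction pp ¬prime[1]
      suc² {suc (suc m)} pp = m , ≡.refl

    mid : Carrier → Carrier → Carrier
    mid x y with suc² q-prime
    ... | m , ≡.refl = frobenius-remainder m q-prime x y

    mid-spec : ∀ x y → (x + y) ^ q ≈ x ^ q + y ^ q + ν q * mid x y
    mid-spec x y with suc² q-prime
    ... | m , ≡.refl = frobenius-+ m q-prime x y

    span-mid : ∀ {f g} → Span μ f → Span μ g → Span μ (λ b → mid (f b) (g b))
    span-mid sf sg with suc² q-prime
    ... | m , ≡.refl = span-sum {suc m} λ k →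
      span-scale (+ proj₁ (cross m q-prime k)) (span-* (span-^ sf (suc (toℕ k))) (span-^ sg (suc m ℕ.∸ toℕ k)))

    0^q≈0 : ∀ {x} → x ≈ 0# → x ^ q ≈ 0#
    0^q≈0 x≈0 with suc² q-prime
    ... | m , ≡.refl = 0^suc≈0 (suc m) x≈0

    lift-cong : ∀ {f g} → (∀ b → f b ≈ g b) → FrobeniusLift f → FrobeniusLift g
    lift-cong f≈g (mkLift sf h sh e) = mkLift (span-cong f≈g sf) h sh λ b →
      trans (^-congˡ q (sym (f≈g b))) (trans (e b) (+-congʳ (f≈g (q ℕ.* b))))

    lift-0 : FrobeniusLift (λ _ → 0#)
    lift-0 = mkLift span-0 (λ _ → 0#) span-0 λ b →
      trans (0^q≈0 refl) (sym (trans (+-identityˡ _) (zeroʳ _)))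

    lift-μ : ∀ l → FrobeniusLift (μ l ^_)
    lift-μ l = mkLift (span-μ l) (λ _ → 0#) span-0 λ b → begin
      (μ l ^ b) ^ q              ≈⟨ ^-assocʳ (μ l) b q ⟩
      μ l ^ (b ℕ.* q)            ≈⟨ ^-congʳ (μ l) (ℕ.*-comm b q) ⟩
      μ l ^ (q ℕ.* b)            ≈⟨ +-identityʳ _ ⟨
      μ l ^ (q ℕ.* b) + 0#       ≈⟨ +-congˡ (zeroʳ (ν q)) ⟨
      μ l ^ (q ℕ.* b) + ν q * 0# ∎

    lift-+ : ∀ {f g} → FrobeniusLift f → FrobeniusLift g → FrobeniusLift (λ b → f b + g b)
    lift-+ {f} {g} (mkLift sf h sh e) (mkLift sg k sk e′) =
      mkLift (span-+ sf sg) (λ b → h b + k b + mid (f b) (g b)) (span-+ (span-+ sh sk) (span-mid sf sg)) λ b →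
      trans (mid-spec (f b) (g b)) (trans (+-congʳ (+-cong (e b) (e′ b))) (collect _ _ _ _ _ _))

    -- Expanding `0 = (f + (- f))^q` by the Frobenius formula determines `(- f)^q`, without
    -- distinguishing `q = 2` from odd `q`.
    lift-neg : ∀ {f} → FrobeniusLift f → FrobeniusLift (λ b → - f b)
    lift-neg {f} (mkLift sf h sh e) =
      mkLift (span-neg sf) (λ b → - (h b + mid (f b) (- f b))) (span-neg (span-+ sh (span-mid sf (span-neg sf)))) λ b →
      begin
      (- f b) ^ q
        ≈⟨ solve-y (f b ^ q) ((- f b) ^ q) (f (q ℕ.* b)) (h b) (ν q) (mid (f b) (- f b)) ⟩
      (f b ^ q + (- f b) ^ q + ν q * mid (f b) (- f b)) - (f b ^ q - (f (q ℕ.* b) + ν q * h b))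
        - (f (q ℕ.* b) + ν q * (h b + mid (f b) (- f b)))
        ≈⟨ +-congʳ (+-cong (trans (sym (mid-spec (f b) (- f b))) (0^q≈0 (-‿inverseʳ (f b))))
                           (-‿cong (trans (+-congʳ (e b)) (-‿inverseʳ _)))) ⟩
      0# - 0# - (f (q ℕ.* b) + ν q * (h b + mid (f b) (- f b)))
        ≈⟨ trans (simplify-neg _) (neg-form _ _ _) ⟩
      - f (q ℕ.* b) + ν q * - (h b + mid (f b) (- f b)) ∎

    lift-ν-scale : ∀ n {f} → FrobeniusLift f → FrobeniusLift (λ b → ν n * f b)
    lift-ν-scale zero    lf = lift-cong (λ b → sym (trans (*-congʳ ι-0) (zeroˡ _))) lift-0
    lift-ν-scale (suc n) {f} lf = lift-cong
      (λ b → trans (sym (+-congˡ (·≈ν* n (f b)))) (·≈ν* (suc n) (f b))) (lift-+ lf (lift-ν-scale n lf))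

    lift-scale : ∀ n {f} → FrobeniusLift f → FrobeniusLift (λ b → ι n * f b)
    lift-scale (+ n)      lf = lift-ν-scale n lf
    lift-scale -[1+ n ] {f} lf = lift-cong
      (λ b → trans (-‿distribˡ-* _ _) (*-congʳ (sym (ι-neg (+ suc n))))) (lift-neg (lift-ν-scale (suc n) lf))

    lift-sum : ∀ {n} {f : Fin n → ℕ → Carrier} → (∀ i → FrobeniusLift (f i)) →
               FrobeniusLift (λ b → sum (λ i → f i b))
    lift-sum {zero}  lf = lift-0
    lift-sum {suc n} lf = lift-+ (lf zero) (lift-sum (λ i → lf (suc i)))

    -- On a single exponential the congruence is the identity `(μ^b)^q = μ^(q b)` with remainder 0;
    -- it passes to sums and negatives, hence to integer combinations.
    frobeniusLift : ∀ {f} → Span μ f → FrobeniusLift f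
    frobeniusLift (mkSpan z e) = lift-cong (λ b → sym (e b)) (lift-sum {s} λ l → lift-scale (z l) (lift-μ l))

-- Sums of torsion elements

module TorsionSums {c ℓ} (R : CommutativeRing c ℓ)
  (ι : ℤ → CommutativeRing.Carrier R)
  (ι-hom : RingMorphisms.IsRingHomomorphism ℤ-ring (CommutativeRing.rawRing R) ι)
  (ι-inverse : Integers.InvertibleIntegers R ι ι-hom)
  (1≉0 : RingSum.Nontrivial R) (reduced : RingSum.Reduced R) (local : RingSum.Local R)
  where
  open RingSum R
  open Integers R ι ι-hom
  open Solver using (solve; _:+_; _:*_; _:-_; :-_; _:=_)

  ι-regular : ∀ n → n ≢ 0ℤ → Regular (ι n)
  ι-regular n n≢0 y ny≈0 = let r , nr≈1 = ι-inverse n n≢0 in begin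
    y               ≈⟨ *-identityˡ y ⟨
    1# * y          ≈⟨ *-congʳ (trans (*-comm r (ι n)) nr≈1) ⟨
    r * ι n * y     ≈⟨ *-assoc r (ι n) y ⟩
    r * (ι n * y)   ≈⟨ *-congˡ ny≈0 ⟩
    r * 0#          ≈⟨ zeroʳ r ⟩
    0#              ∎

  ι-injective : ∀ m n → ι m ≈ ι n → m ≡ n
  ι-injective m n h with m ℤ.- n ℤ.≟ 0ℤ
  ... | yes d≡0 = ℤ.i-j≡0⇒i≡j m n d≡0
  ... | no  d≢0 = contradiction (ι-regular (m ℤ.- n) d≢0 1# (trans (*-identityʳ _)
    (trans (ι-+ m (ℤ.- n)) (trans (+-congˡ (ι-neg n)) (trans (+-congʳ h) (-‿inverseʳ _)))))) 1≉0

  regular-≉0 : ∀ {x} → Regular x → ¬ x ≈ 0#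
  regular-≉0 reg x≈0 = 1≉0 (reg 1# (trans (*-congʳ x≈0) (zeroˡ 1#)))

  regular-* : ∀ {x y} → Regular x → Regular y → Regular (x * y)
  regular-* rx ry w h = ry w (rx _ (trans (sym (*-assoc _ _ _)) h))

  regular-factor : ∀ {x y} → Regular (x * y) → Regular x
  regular-factor {x} {y} r w h = r w (begin
    x * y * w    ≈⟨ *-congʳ (*-comm x y) ⟩
    y * x * w    ≈⟨ *-assoc y x w ⟩
    y * (x * w)  ≈⟨ *-congˡ h ⟩
    y * 0#       ≈⟨ zeroʳ y ⟩
    0#           ∎)

  regular-cong : ∀ {x y} → x ≈ y → Regular x → Regular y
  regular-cong x≈y r w h = r w (trans (*-congʳ x≈y) h)

  regular-^ : ∀ {x} → Regular x → ∀ n → Regular (x ^ n)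
  regular-^ r zero    w h = trans (sym (*-identityˡ w)) h
  regular-^ r (suc n) = regular-* r (regular-^ r n)

  ^≈0⇒≈0 : ∀ x n → x ^ n ≈ 0# → x ≈ 0#
  ^≈0⇒≈0 x zero          h = contradiction h 1≉0
  ^≈0⇒≈0 x (suc zero)    h = trans (sym (*-identityʳ x)) h
  ^≈0⇒≈0 x (suc (suc n)) h = ^≈0⇒≈0 x (suc n) (reduced _ (begin
    x ^ suc n * x ^ suc n     ≈⟨ ^-homo-* x (suc n) (suc n) ⟨
    x ^ (suc n ℕ.+ suc n)     ≈⟨ ^-congʳ x (≡.cong suc (ℕ.+-comm n (suc n))) ⟩
    x ^ (suc (suc n) ℕ.+ n)   ≈⟨ ^-homo-* x (suc (suc n)) n ⟩
    x ^ suc (suc n) * x ^ n   ≈⟨ *-congʳ h ⟩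
    0# * x ^ n                ≈⟨ zeroˡ _ ⟩
    0#                        ∎))

  -- Integer polynomials and their lowest terms.

  eval : ∀ {n} → (Fin n → ℤ) → Carrier → Carrier
  eval {zero}  x t = 0#
  eval {suc n} x t = ι (x zero) + t * eval (x ∘ suc) t

  eval≈sum : ∀ {n} (x : Fin n → ℤ) t → eval x t ≈ sum (λ k → ι (x k) * t ^ toℕ k)
  eval≈sum {zero}  x t = refl
  eval≈sum {suc n} x t = +-cong (sym (*-identityʳ _)) (begin
    t * eval (x ∘ suc) t
      ≈⟨ *-congˡ (eval≈sum (x ∘ suc) t) ⟩
    t * sum (λ k → ι (x (suc k)) * t ^ toℕ k)
      ≈⟨ *-distribˡ-sum {n} t _ ⟩
    sum (λ k → t * (ι (x (suc k)) * t ^ toℕ k))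
      ≈⟨ sum-cong-≋ {n} (λ k → solve 3 (λ t a p → t :* (a :* p) := a :* (t :* p)) refl t _ _) ⟩
    sum (λ k → ι (x (suc k)) * (t * t ^ toℕ k)) ∎)

  -- Splitting off `t^order` leaves a factor with nonzero constant term, on which the case split in
  -- `support` rests.
  record LowestTerm {n} (x : Fin n → ℤ) : Set (c Level.⊔ ℓ) where
    field
      order       : ℕ
      lowest      : ℤ
      lowest≢0    : lowest ≢ 0ℤ
      {tail-size} : ℕ
      tail        : Fin tail-size → ℤ
      factor      : ∀ t → eval x t ≈ t ^ order * (ι lowest + t * eval tail t)

  lowest-term : ∀ {n} (x : Fin n → ℤ) i → x i ≢ 0ℤ → LowestTerm x
  lowest-term {suc n} x i xi≢0 with x zero ℤ.≟ 0ℤ | i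
  ... | no x₀≢0  | _ = record
    { order = 0 ; lowest = x zero ; lowest≢0 = x₀≢0 ; tail = x ∘ suc ; factor = λ t → sym (*-identityˡ _) }
  ... | yes x₀≡0 | zero  = contradiction x₀≡0 xi≢0
  ... | yes x₀≡0 | suc j = record
    { order = suc order ; lowest = lowest ; lowest≢0 = lowest≢0 ; tail = tail
    ; factor = λ t → begin
        ι (x zero) + t * eval (x ∘ suc) t
          ≈⟨ +-cong (trans (ι-cong x₀≡0) ι-0) (*-congˡ (factor t)) ⟩
        0# + t * (t ^ order * (ι lowest + t * eval tail t))
          ≈⟨ trans (+-identityˡ _) (sym (*-assoc _ _ _)) ⟩
        t * t ^ order * (ι lowest + t * eval tail t) ∎
    }
    where open LowestTerm (lowest-term (x ∘ suc) j xi≢0)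

  module _ {s : ℕ} (μ : Fin s → Carrier)
    (μ-one : Σ (Fin s) λ l → μ l ≈ 1#)
    (μ-mul : ∀ i j → Σ (Fin s) λ l → μ i * μ j ≈ μ l)
    where
    open SpanProperties μ μ-one μ-mul

    span-eval : ∀ {n} (x : Fin n → ℤ) {f} → Span μ f → Span μ (λ b → eval x (f b))
    span-eval {zero}  x sf = span-0
    span-eval {suc n} x sf = span-+ (span-const (x zero)) (span-* sf (span-eval (x ∘ suc) sf))

    -- The `s + 1` powers `f^0, ..., f^s` have coefficient vectors in `ℤ^s`, so these are linearly
    -- dependent. Being a relation between coefficients, it holds at all `b` simultaneously.
    algebraic : ∀ {f} → Span μ f →
      Σ (Fin (suc s) → ℤ) λ x → (Σ (Fin (suc s)) λ i → x i ≢ 0ℤ) × (∀ b → eval x (f b) ≈ 0#)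
    algebraic {f} sf = x , nonzero , vanishes
      where
      v : Fin (suc s) → Fin s → ℤ
      v k = coeff (span-^ sf (toℕ k))
      dep = linear-dependence s v
      x = proj₁ dep
      nonzero = proj₁ (proj₂ dep)
      relation = proj₂ (proj₂ dep)
      vanishes : ∀ b → eval x (f b) ≈ 0#
      vanishes b = begin
        eval x (f b)
          ≈⟨ eval≈sum x (f b) ⟩
        sum {suc s} (λ k → ι (x k) * f b ^ toℕ k)
          ≈⟨ sum-cong-≋ {suc s} (λ k →
               trans (*-congˡ (expand (span-^ sf (toℕ k)) b)) (*-distribˡ-sum {s} (ι (x k)) _)) ⟩
        sum {suc s} (λ k → sum {s} (λ l → ι (x k) * (ι (v k l) * μ l ^ b)))
          ≈⟨ ∑-comm {suc s} {s} (λ k l → ι (x k) * (ι (v k l) * μ l ^ b)) ⟩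
        sum {s} (λ l → sum {suc s} (λ k → ι (x k) * (ι (v k l) * μ l ^ b)))
          ≈⟨ sum-cong-≋ {s} (λ l → sum-cong-≋ {suc s} λ k →
               trans (*-congʳ (ι-* (x k) (v k l))) (*-assoc (ι (x k)) (ι (v k l)) (μ l ^ b))) ⟨
        sum {s} (λ l → sum {suc s} (λ k → ι (x k ℤ.* v k l) * μ l ^ b))
          ≈⟨ sum-cong-≋ {s} (λ l → *-distribʳ-sum {suc s} (μ l ^ b) (λ k → ι (x k ℤ.* v k l))) ⟨
        sum {s} (λ l → sum {suc s} (λ k → ι (x k ℤ.* v k l)) * μ l ^ b)
          ≈⟨ sum-≈0 {s} (λ l → trans
               (*-congʳ (trans (sym (ι-sum {suc s} (λ k → x k ℤ.* v k l))) (trans (ι-cong (relation l)) ι-0)))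
               (zeroˡ (μ l ^ b))) ⟩
        0# ∎

    -- The support of f: a multiple E of f in the group ring that is an integer
    -- multiple d of the indicator function of {b : f b ≉ 0}.
    record Support (f : ℕ → Carrier) : Set (c Level.⊔ ℓ) where
      field
        d       : ℕ
        d≢0     : d ≢ 0
        E       : ℕ → Carrier
        E-span  : Span μ E
        decide  : ∀ b → (f b ≈ 0# × E b ≈ 0#) ⊎ (Regular (f b) × E b ≈ ν d)

    -- With `ℓ` the lowest coefficient, the relation reads `f^order (ℓ - E) = 0` for
    -- `E = - f tail(f)`. Locality is applied to `E / ℓ`. If `E / ℓ` is cancellable, so is its
    -- factor `f`, and `E = ℓ`. If `1 - E / ℓ` is cancellable, then `f^order = 0`, so `f = 0`
    -- because the ring is reduced.
    support : ∀ {f} → Span μ f → Support f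
    support {f} sf = record
      -- One further factor `ℓ` turns the value `ℓ`, whose sign is unknown, into the natural number
      -- `ℓ²`.
      { d = ℤ.∣ lowest ∣ ℕ.* ℤ.∣ lowest ∣
      ; d≢0 = λ h → lowest≢0 (ℤ.∣i∣≡0⇒i≡0 ([ id , id ]′ (ℕ.m*n≡0⇒m≡0∨n≡0 ℤ.∣ lowest ∣ h)))
      ; E = λ b → ι lowest * E b
      ; E-span = span-scale lowest E-span
      ; decide = decide
      }
      where
      alg = algebraic sf
      open LowestTerm (lowest-term (proj₁ alg) (proj₁ (proj₁ (proj₂ alg))) (proj₂ (proj₁ (proj₂ alg))))
      G E : ℕ → Carrier
      G b = - eval tail (f b)
      E b = f b * G b
      E-span : Span μ E
      E-span = span-* sf (span-neg (span-eval tail sf))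
      rearrange : ∀ a t e → a + t * e ≈ a - t * - e
      rearrange = solve 3 (λ a t e → a :+ t :* e := a :- t :* :- e) refl
      annihilates : ∀ b → f b ^ order * (ι lowest - E b) ≈ 0#
      annihilates b = trans (*-congˡ (sym (rearrange _ _ _)))
        (trans (sym (factor (f b))) (proj₂ (proj₂ alg) b))
      r = proj₁ (ι-inverse lowest lowest≢0)
      lr≈1 = proj₂ (ι-inverse lowest lowest≢0)
      rescale : ∀ b → ι lowest * (1# - r * E b) ≈ ι lowest - E b
      rescale b = begin
        ι lowest * (1# - r * E b)
          ≈⟨ solve 4 (λ l o r e → l :* (o :- r :* e) := l :* o :- l :* r :* e) refl (ι lowest) 1# r (E b) ⟩
        ι lowest * 1# - ι lowest * r * E b
          ≈⟨ +-cong (*-identityʳ _) (-‿cong (trans (*-congʳ lr≈1) (*-identityˡ _))) ⟩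
        ι lowest - E b ∎
      decide : ∀ b → (f b ≈ 0# × ι lowest * E b ≈ 0#) ⊎
                     (Regular (f b) × ι lowest * E b ≈ ν (ℤ.∣ lowest ∣ ℕ.* ℤ.∣ lowest ∣))
      decide b with local (r * E b)
      ... | inj₁ reg = inj₂ (f-regular , (begin
        ι lowest * E b       ≈⟨ *-congˡ (x∙y⁻¹≈ε⇒x≈y _ _ (regular-^ f-regular order _ (annihilates b))) ⟨
        ι lowest * ι lowest  ≈⟨ ι-* lowest lowest ⟨
        ι (lowest ℤ.* lowest) ≈⟨ ι-cong (i*i≡∣i∣*∣i∣ lowest) ⟩
        ν (ℤ.∣ lowest ∣ ℕ.* ℤ.∣ lowest ∣) ∎))
        where
        f-regular : Regular (f b)
        f-regular = regular-factor (regular-cong (trans (*-comm r (E b)) (*-assoc (f b) (G b) r)) reg)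
      ... | inj₂ reg = inj₁ (fb≈0 , trans (*-congˡ (trans (*-congʳ fb≈0) (zeroˡ _))) (zeroʳ _))
        where
        fb≈0 : f b ≈ 0#
        fb≈0 = ^≈0⇒≈0 (f b) order (regular-cong (rescale b) (regular-* (ι-regular lowest lowest≢0) reg) _
          (trans (*-comm _ _) (annihilates b)))

    zero-or-regular : ∀ {f} → Span μ f → ∀ b → f b ≈ 0# ⊎ Regular (f b)
    zero-or-regular sf b = [ inj₁ ∘ proj₁ , inj₂ ∘ proj₁ ]′ (Support.decide (support sf) b)

    module _ {N : ℕ} (N≢0 : N ≢ 0) (torsion : ∀ l → μ l ^ N ≈ 1#) where

      -- The span element `b ↦ μ l ^ b - 1`, tested at `b = 1`, decides whether `μ l` is 1. If so,
      -- the sum is `N`; otherwise `μ l - 1` is cancellable and its product with the geometric sum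
      -- is 0.
      torsion-sum : ∀ l → Σ ℤ λ t → sum {N} (λ b → μ l ^ toℕ b) ≈ ι t
      torsion-sum l with zero-or-regular (span-+ (span-μ l) (span-neg span-1)) 1
      ... | inj₁ μ-1≈0 = + N , (begin
        sum {N} (λ b → μ l ^ toℕ b)
          ≈⟨ sum-cong-≋ {N} (λ b → trans (^-congˡ (toℕ b) μ≈1) (1^n≈1 (toℕ b))) ⟩
        sum {N} (λ _ → 1#)
          ≈⟨ sum-replicate N ⟩
        N · 1#
          ≈⟨ trans (·≈ν* N 1#) (*-identityʳ _) ⟩
        ν N ∎)
        where
        μ≈1 : μ l ≈ 1#
        μ≈1 = trans (sym (*-identityʳ _)) (x∙y⁻¹≈ε⇒x≈y _ _ μ-1≈0)
      ... | inj₂ regular = 0ℤ , trans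
        (regular-cong (+-congʳ (*-identityʳ (μ l))) regular _
          (trans (geometric-sum (μ l) N) (x≈y⇒x∙y⁻¹≈ε (torsion l))))
        (sym ι-0)

      trace-integral : ∀ {f} → Span μ f → Σ ℤ λ t → sum {N} (λ b → f (toℕ b)) ≈ ι t
      trace-integral {f} (mkSpan z e) = ℤΣ.sum (λ l → z l ℤ.* proj₁ (torsion-sum l)) , (begin
        sum {N} (λ b → f (toℕ b))
          ≈⟨ sum-cong-≋ {N} (λ b → e (toℕ b)) ⟩
        sum {N} (λ b → sum {s} (λ l → ι (z l) * μ l ^ toℕ b))
          ≈⟨ ∑-comm {N} {s} (λ b l → ι (z l) * μ l ^ toℕ b) ⟩
        sum {s} (λ l → sum {N} (λ b → ι (z l) * μ l ^ toℕ b))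
          ≈⟨ sum-cong-≋ {s} (λ l → *-distribˡ-sum {N} (ι (z l)) (λ b → μ l ^ toℕ b)) ⟨
        sum {s} (λ l → ι (z l) * sum {N} (λ b → μ l ^ toℕ b))
          ≈⟨ sum-cong-≋ {s} (λ l → trans (ι-* (z l) _) (*-congˡ (sym (proj₂ (torsion-sum l))))) ⟨
        sum {s} (λ l → ι (z l ℤ.* proj₁ (torsion-sum l)))
          ≈⟨ ι-sum (λ l → z l ℤ.* proj₁ (torsion-sum l)) ⟨
        ι (ℤΣ.sum (λ l → z l ℤ.* proj₁ (torsion-sum l))) ∎)

      -- Zeros of exponential sums under dilation.

      module _ {f : ℕ → Carrier} (sf : Span μ f) where
        open Support (support sf)

        module _ {q : ℕ} (q-prime : Prime q) (q∤d : q ∤ d) where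
          private
            module E-lift = FrobeniusLift (frobeniusLift μ μ-one μ-mul q-prime E-span)
            -- For a constant function the lift is Fermat's little theorem, `d^q = d + q r`.
            module d-lift = FrobeniusLift (frobeniusLift μ μ-one μ-mul q-prime (span-const (+ d)))

            -- The factor `d` in `Δ` comes from comparing `d E^q` with `d^q E`. The values of `Δ`
            -- are 0 and `± d²`; squaring, as in `g`, removes the sign.
            Δ h g : ℕ → Carrier
            Δ b = ν d * (E b - E (q ℕ.* b))
            h b = ν d * E-lift.remainder b - d-lift.remainder b * E b
            g b = h b * h b

            g-span : Span μ g
            g-span = span-* h-span h-span
              where h-span = span-+ (span-* (span-const (+ d)) E-lift.remainder-inSpan)
                                    (span-neg (span-* d-lift.remainder-inSpan E-span))

            E^q*d≈d^q*E : ∀ b → E b ^ q * ν d ≈ ν d ^ q * E b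
            E^q*d≈d^q*E b with decide b
            ... | inj₁ (_ , Eb≈0) = trans (*-congʳ (0^q≈0 μ μ-one μ-mul q-prime Eb≈0))
              (trans (zeroˡ _) (sym (trans (*-congˡ Eb≈0) (zeroʳ _))))
            ... | inj₂ (_ , Eb≈d) = *-cong (^-congˡ q Eb≈d) (sym Eb≈d)

            -- d Eᵠ = dᵠ E because E takes only the values 0 and d; reduce both sides modulo q.
            Δ≈q*h : ∀ b → Δ b ≈ ν q * h b
            Δ≈q*h b = begin
              ν d * (E b - E (q ℕ.* b))
                ≈⟨ solve 6 (λ d e e′ k r q → d :* (e :- e′) :=
                     ((d :+ q :* r) :* e :- (e′ :+ q :* k) :* d) :+ q :* (d :* k :- r :* e)) refl
                     (ν d) (E b) (E (q ℕ.* b)) (E-lift.remainder b) (d-lift.remainder b) (ν q) ⟩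
              ((ν d + ν q * d-lift.remainder b) * E b - (E (q ℕ.* b) + ν q * E-lift.remainder b) * ν d) + ν q * h b
                ≈⟨ +-congʳ (x≈y⇒x∙y⁻¹≈ε (trans (*-congʳ (sym (d-lift.lift b)))
                     (trans (sym (E^q*d≈d^q*E b)) (*-congʳ (E-lift.lift b))))) ⟩
              0# + ν q * h b
                ≈⟨ +-identityˡ _ ⟩
              ν q * h b ∎

            A = (d ℕ.* d) ℕ.* (d ℕ.* d)

            -- `χ` marks the `b` at which `E b` and `E (q b)` differ, as a natural number so that
            -- such `b` can be counted; `A = d⁴` is the value of `Δ²` there.
            Change : ℕ → Set ℓ
            Change b = Σ ℕ λ χ → χ ℕ.≤ 1 × Δ b * Δ b ≈ ν A * ν χ × (χ ≡ 0 → f b ≈ 0# → f (q ℕ.* b) ≈ 0#)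

            no-change : ∀ {b} → E b ≈ E (q ℕ.* b) → Δ b * Δ b ≈ ν A * ν 0
            no-change e = trans (*-congˡ (trans (*-congˡ (x≈y⇒x∙y⁻¹≈ε e)) (zeroʳ _)))
              (trans (zeroʳ _) (sym (trans (*-congˡ ι-0) (zeroʳ _))))

            νA : ν A ≈ (ν d * ν d) * (ν d * ν d)
            νA = trans (ν-* (d ℕ.* d) (d ℕ.* d)) (*-cong (ν-* d d) (ν-* d d))

            full-change : ∀ {b} → (E b - E (q ℕ.* b)) * (E b - E (q ℕ.* b)) ≈ ν d * ν d → Δ b * Δ b ≈ ν A * ν 1
            full-change {b} e = begin
              Δ b * Δ b
                ≈⟨ solve 2 (λ d x → d :* x :* (d :* x) := (d :* d) :* (x :* x)) refl (ν d) (E b - E (q ℕ.* b)) ⟩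
              (ν d * ν d) * ((E b - E (q ℕ.* b)) * (E b - E (q ℕ.* b)))
                ≈⟨ *-congˡ e ⟩
              (ν d * ν d) * (ν d * ν d)
                ≈⟨ trans (*-congˡ ι-1) (trans (*-identityʳ _) νA) ⟨
              ν A * ν 1 ∎

            x-0 : ∀ x → x - 0# ≈ x
            x-0 x = trans (+-congˡ -0#≈0#) (+-identityʳ x)

            change : ∀ b → Change b
            change b with decide b | decide (q ℕ.* b)
            ... | inj₁ (_ , e)   | inj₁ (z , e′) = 0 , ℕ.z≤n , no-change (trans e (sym e′)) , λ _ _ → z
            ... | inj₂ (r , e)   | inj₂ (_ , e′) = 0 , ℕ.z≤n , no-change (trans e (sym e′)) ,
                                                   λ _ z → contradiction z (regular-≉0 r)
            ... | inj₁ (_ , e)   | inj₂ (_ , e′) = 1 , ℕ.s≤s ℕ.z≤n , full-change (trans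
                (*-cong E-E≈-d E-E≈-d) (solve 1 (λ x → :- x :* :- x := x :* x) refl (ν d))) , λ ()
              where
              E-E≈-d : E b - E (q ℕ.* b) ≈ - ν d
              E-E≈-d = trans (+-cong e (-‿cong e′)) (+-identityˡ _)
            ... | inj₂ (_ , e)   | inj₁ (_ , e′) = 1 , ℕ.s≤s ℕ.z≤n , full-change (*-cong E-E≈d E-E≈d) , λ ()
              where
              E-E≈d : E b - E (q ℕ.* b) ≈ ν d
              E-E≈d = trans (+-cong e (-‿cong e′)) (x-0 _)

            χ : ℕ → ℕ
            χ b = proj₁ (change b)

            χ^N≡χ : ∀ b → χ b ℕ.^ N ≡ χ b
            χ^N≡χ b = idem (χ b) N (proj₁ (proj₂ (change b))) N≢0
              where
              idem : ∀ x n → x ℕ.≤ 1 → n ≢ 0 → x ℕ.^ n ≡ x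
              idem x zero    _ n≢0 = contradiction ≡.refl n≢0
              idem zero (suc n) _ _ = ≡.refl
              idem (suc zero) (suc n) _ _ = ℕ.^-zeroˡ (suc n)
              idem (suc (suc x)) (suc n) (ℕ.s≤s ()) _

            -- The equation `q² g = Δ² = A χ` is raised to the power `N`. This leaves `χ` unchanged,
            -- since `χ ≤ 1` and `N ≠ 0`, but brings in a power of `q` exceeding any possible count.
            q²g≈Aχ : ∀ b → ν ((q ℕ.* q) ℕ.^ N) * g b ^ N ≈ ν (A ℕ.^ N) * ν (χ b)
            q²g≈Aχ b = begin
              ν ((q ℕ.* q) ℕ.^ N) * g b ^ N
                ≈⟨ *-congʳ (ν-^ (q ℕ.* q) N) ⟩
              ν (q ℕ.* q) ^ N * g b ^ N
                ≈⟨ ^-distrib-* _ _ N ⟨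
              (ν (q ℕ.* q) * g b) ^ N
                ≈⟨ ^-congˡ N (begin
                     ν (q ℕ.* q) * (h b * h b)
                       ≈⟨ *-congʳ (ν-* q q) ⟩
                     (ν q * ν q) * (h b * h b)
                       ≈⟨ solve 2 (λ d x → d :* x :* (d :* x) := (d :* d) :* (x :* x)) refl (ν q) (h b) ⟨
                     (ν q * h b) * (ν q * h b)
                       ≈⟨ *-cong (Δ≈q*h b) (Δ≈q*h b) ⟨
                     Δ b * Δ b
                       ≈⟨ proj₁ (proj₂ (proj₂ (change b))) ⟩
                     ν A * ν (χ b) ∎) ⟩
              (ν A * ν (χ b)) ^ N
                ≈⟨ ^-distrib-* _ _ N ⟩
              ν A ^ N * ν (χ b) ^ N
                ≈⟨ *-cong (ν-^ A N) (ν-^ (χ b) N) ⟨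
              ν (A ℕ.^ N) * ν (χ b ℕ.^ N)
                ≡⟨ ≡.cong (λ x → ν (A ℕ.^ N) * ν x) (χ^N≡χ b) ⟩
              ν (A ℕ.^ N) * ν (χ b) ∎

            ν-sum : ∀ {n} (f : Fin n → ℕ) → ν (ℕΣ.sum f) ≈ sum (λ i → ν (f i))
            ν-sum {zero}  f = ι-0
            ν-sum {suc n} f = trans (ι-+ (+ f zero) _) (+-congˡ (ν-sum (f ∘ suc)))

            count = ℕΣ.sum {N} (λ b → χ (toℕ b))
            t = trace-integral (span-^ g-span N)

            integer-equation : + ((q ℕ.* q) ℕ.^ N) ℤ.* proj₁ t ≡ + (A ℕ.^ N) ℤ.* + count
            integer-equation = ι-injective _ _ (begin
              ι (+ ((q ℕ.* q) ℕ.^ N) ℤ.* proj₁ t)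
                ≈⟨ ι-* _ _ ⟩
              ν ((q ℕ.* q) ℕ.^ N) * ι (proj₁ t)
                ≈⟨ *-congˡ (proj₂ t) ⟨
              ν ((q ℕ.* q) ℕ.^ N) * sum {N} (λ b → g (toℕ b) ^ N)
                ≈⟨ *-distribˡ-sum {N} _ _ ⟩
              sum {N} (λ b → ν ((q ℕ.* q) ℕ.^ N) * g (toℕ b) ^ N)
                ≈⟨ sum-cong-≋ {N} (λ b → q²g≈Aχ (toℕ b)) ⟩
              sum {N} (λ b → ν (A ℕ.^ N) * ν (χ (toℕ b)))
                ≈⟨ *-distribˡ-sum {N} _ _ ⟨
              ν (A ℕ.^ N) * sum {N} (λ b → ν (χ (toℕ b)))
                ≈⟨ *-congˡ (ν-sum {N} (λ b → χ (toℕ b))) ⟨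
              ν (A ℕ.^ N) * ν count
                ≈⟨ ι-* _ _ ⟨
              ι (+ (A ℕ.^ N) ℤ.* + count) ∎)

            -- Summing `g^N` over a period gives an integer, so `q^N` divides `A^N count`, and
            -- therefore `count`, as `q ∤ A`. But `count ≤ N < q^N`.
            count≡0 : count ≡ 0
            count≡0 = large-prime-power∣⇒≡0 q-prime N (sum-≤1 _ (λ b → proj₁ (proj₂ (change (toℕ b)))))
              (prime-power∣⇒∣ q-prime (prime∤^ q-prime q∤A N) N
                (∣-trans q^N∣ (∣-reflexive nat-equation)))
              where
              q∤d² : q ∤ d ℕ.* d
              q∤d² h′ = [ q∤d , q∤d ]′ (euclidsLemma d d q-prime h′)
              q∤A : q ∤ A
              q∤A h′ = [ q∤d² , q∤d² ]′ (euclidsLemma (d ℕ.* d) (d ℕ.* d) q-prime h′)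
              nat-equation : (q ℕ.* q) ℕ.^ N ℕ.* ℤ.∣ proj₁ t ∣ ≡ A ℕ.^ N ℕ.* count
              nat-equation = ≡.trans (≡.sym (ℤ.abs-* (+ ((q ℕ.* q) ℕ.^ N)) (proj₁ t)))
                (≡.trans (≡.cong ℤ.∣_∣ integer-equation) (ℤ.abs-* (+ (A ℕ.^ N)) (+ count)))
              q^N∣ : q ℕ.^ N ∣ (q ℕ.* q) ℕ.^ N ℕ.* ℤ.∣ proj₁ t ∣
              q^N∣ = ∣m⇒∣m*n ℤ.∣ proj₁ t ∣ (^-monoˡ-∣ N (m∣m*n q))

          zero-dilate-prime : ∀ b → f b ≈ 0# → f (q ℕ.* b) ≈ 0#
          zero-dilate-prime b fb≈0 = begin
            f (q ℕ.* b)
              ≡⟨ ≡.cong f index ⟩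
            f (q ℕ.* r ℕ.+ N ℕ.* (q ℕ.* k))
              ≈⟨ span-periodic N torsion sf _ _ ⟩
            f (q ℕ.* r)
              ≈⟨ proj₂ (proj₂ (proj₂ (change r))) χr≡0 fr≈0 ⟩
            0# ∎
            where
            instance N-nonZero = ℕ.≢-nonZero N≢0
            -- `count≡0` controls only the residues `0, ..., N - 1`, so `b` is first reduced modulo
            -- `N` by periodicity.
            r = b % N
            k = b / N
            b≡ : b ≡ r ℕ.+ N ℕ.* k
            b≡ = ≡.trans (m≡m%n+[m/n]*n b N) (≡.cong (r ℕ.+_) (ℕ.*-comm k N))
            index : q ℕ.* b ≡ q ℕ.* r ℕ.+ N ℕ.* (q ℕ.* k)
            index = ≡.trans (≡.cong (q ℕ.*_) b≡) (≡.trans (ℕ.*-distribˡ-+ q r (N ℕ.* k))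
              (≡.cong (q ℕ.* r ℕ.+_) (≡.trans (≡.sym (ℕ.*-assoc q N k))
                (≡.trans (≡.cong (ℕ._* k) (ℕ.*-comm q N)) (ℕ.*-assoc N q k)))))
            fr≈0 : f r ≈ 0#
            fr≈0 = trans (sym (span-periodic N torsion sf r k)) (trans (reflexive (≡.cong f (≡.sym b≡))) fb≈0)
            χr≡0 : χ r ≡ 0
            χr≡0 = ≡.trans (≡.cong χ (≡.sym (toℕ-fromℕ< (m%n<n b N))))
                           (sum≡0⇒≡0 {N} (λ b → χ (toℕ b)) count≡0 (fromℕ< (m%n<n b N)))

        zero-dilate : ∀ {a} → a ≢ 0 → NoCommonPrime a d → ∀ b → f b ≈ 0# → f (a ℕ.* b) ≈ 0#
        zero-dilate {a} a≢0 = prime-induction P base step a a≢0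
          where
          P : ℕ → Set ℓ
          P a = NoCommonPrime a d → ∀ b → f b ≈ 0# → f (a ℕ.* b) ≈ 0#
          base : P 1
          base _ b h = trans (reflexive (≡.cong f (ℕ.*-identityˡ b))) h
          step : ∀ p n → Prime p → n ≢ 0 → P n → P (p ℕ.* n)
          step p n pp _ ih ⊥d b h = trans (reflexive (≡.cong f (ℕ.*-assoc p n b)))
            (zero-dilate-prime pp (⊥d pp (m∣m*n n)) (n ℕ.* b)
              (ih (λ q-prime q∣n → ⊥d q-prime (∣n⇒∣m*n p q∣n)) b h))

        -- Some `a + N t` is prime to `d`. Periodicity makes `f` agree at `a` and `a + N t`, and the
        -- latter is reached from 1 by dilations with primes not dividing `d`.
        zero-conjugate : ∀ {a} → a ≢ 0 → NoCommonPrime a N → f 1 ≈ 0# → f a ≈ 0#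
        zero-conjugate {a} a≢0 a⊥N f1≈0 = trans (sym (span-periodic N torsion sf a t))
          (trans (reflexive (≡.cong f (≡.sym (ℕ.*-identityʳ _))))
            (zero-dilate (λ h → a≢0 (ℕ.m+n≡0⇒m≡0 a h)) (proj₂ shifted) 1 f1≈0))
          where
          shifted = shift-avoiding a⊥N d d≢0
          t = proj₁ shifted

  -- Finite monoids of roots of unity.

  record TorsionMonoid (N : ℕ) : Set (c Level.⊔ ℓ) where
    no-eta-equality
    field
      {size}  : ℕ
      μ       : Fin size → Carrier
      one     : Σ (Fin size) λ l → μ l ≈ 1#
      mul     : ∀ i j → Σ (Fin size) λ l → μ i * μ j ≈ μ l
      torsion : ∀ l → μ l ^ N ≈ 1#

    Member : Carrier → Set ℓ
    Member x = Σ (Fin size) λ l → x ≈ μ l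

    open SpanProperties μ one mul

    member-1 : Member 1#
    member-1 = proj₁ one , sym (proj₂ one)

    member-* : ∀ {x y} → Member x → Member y → Member (x * y)
    member-* (i , x≈) (j , y≈) = let l , e = mul i j in l , trans (*-cong x≈ y≈) e

    member-^ : ∀ {x} → Member x → ∀ n → Member (x ^ n)
    member-^ mx zero    = member-1
    member-^ mx (suc n) = member-* mx (member-^ mx n)

    span-member : ∀ {x} → Member x → Span μ (x ^_)
    span-member (l , x≈) = span-cong (λ b → ^-congˡ b (sym x≈)) (span-μ l)

    abstract
      one-or-regular : ∀ {x} → Member x → x ≈ 1# ⊎ Regular (x - 1#)
      one-or-regular {x} mx with zero-or-regular μ one mul (span-+ (span-member mx) (span-neg span-1)) 1
      ... | inj₁ h = inj₁ (trans (sym (*-identityʳ x)) (x∙y⁻¹≈ε⇒x≈y _ _ h))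
      ... | inj₂ h = inj₂ (regular-cong (+-congʳ (*-identityʳ x)) h)

      -- This is `zero-conjugate` for the span element `b ↦ Σ zᵢ ζᵢ^b`, whose value at 1 is the
      -- given sum.
      conjugate : N ≢ 0 → ∀ {n} (z : Fin n → ℤ) {ζ : Fin n → Carrier} → (∀ i → Member (ζ i)) →
                  ∀ {a} → a ≢ 0 → NoCommonPrime a N →
                  sum (λ i → ι (z i) * ζ i) ≈ 0# → sum (λ i → ι (z i) * ζ i ^ a) ≈ 0#
      conjugate N≢0 {n} z mζ a≢0 a⊥N h =
        zero-conjugate μ one mul N≢0 torsion (span-sum {n} λ i → span-scale (z i) (span-member (mζ i))) a≢0 a⊥N
          (trans (sum-cong-≋ {n} λ i → *-congˡ (*-identityʳ _)) h)

  open TorsionMonoid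

  ^-% : ∀ {N} .{{_ : ℕ.NonZero N}} {x} → x ^ N ≈ 1# → ∀ n → x ^ n ≈ x ^ (n % N)
  ^-% {N} {x} h n = begin
    x ^ n
      ≡⟨ ≡.cong (x ^_) (≡.trans (m≡m%n+[m/n]*n n N) (≡.cong (n % N ℕ.+_) (ℕ.*-comm (n / N) N))) ⟩
    x ^ (n % N ℕ.+ N ℕ.* (n / N))
      ≈⟨ ^-homo-* x (n % N) (N ℕ.* (n / N)) ⟩
    x ^ (n % N) * x ^ (N ℕ.* (n / N))
      ≈⟨ trans (*-congˡ (power-torsion x N h (n / N))) (*-identityʳ _) ⟩
    x ^ (n % N) ∎

  trivialMonoid : ∀ N → TorsionMonoid N
  trivialMonoid N = record
    { μ = λ (_ : Fin 1) → 1# ; one = zero , refl ; mul = λ _ _ → zero , *-identityˡ 1# ; torsion = λ _ → 1^n≈1 N }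

  module _ {N : ℕ} {{_ : ℕ.NonZero N}} (T : TorsionMonoid N) (x : Carrier) (x^N≈1 : x ^ N ≈ 1#) where
    private
      μ′ : Fin (size T ℕ.* N) → Carrier
      μ′ k = μ T (proj₁ (remQuot N k)) * x ^ toℕ (proj₂ (remQuot {size T} N k))

      member′ : ∀ l e → Σ (Fin (size T ℕ.* N)) λ k → μ T l * x ^ e ≈ μ′ k
      member′ l e = combine l (fromℕ< (m%n<n e N)) , (begin
        μ T l * x ^ e
          ≈⟨ *-congˡ (^-% x^N≈1 e) ⟩
        μ T l * x ^ (e % N)
          ≡⟨ ≡.cong (λ k → μ T l * x ^ k) (toℕ-fromℕ< (m%n<n e N)) ⟨
        μ T l * x ^ toℕ (fromℕ< (m%n<n e N))
          ≡⟨ ≡.cong (λ r → μ T (proj₁ r) * x ^ toℕ (proj₂ r)) (remQuot-combine l (fromℕ< (m%n<n e N))) ⟨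
        μ′ (combine l (fromℕ< (m%n<n e N))) ∎)

    -- The enumeration by `μ l x^e` with `e < N` may repeat elements. Since repetitions are
    -- harmless, no test is made whether a power of `x` is already present.
    adjoin : TorsionMonoid N
    adjoin = record
      { μ = μ′
      ; one = let k , e = member′ (proj₁ (one T)) 0 in
              k , trans (sym e) (trans (*-identityʳ _) (proj₂ (one T)))
      ; mul = λ i j →
          let l  , a  = remQuot {size T} N i
              l′ , a′ = remQuot {size T} N j
              l″ , e  = mul T l l′
              k  , e′ = member′ l″ (toℕ a ℕ.+ toℕ a′)
          in k , (begin
            μ T l * x ^ toℕ a * (μ T l′ * x ^ toℕ a′)
              ≈⟨ solve 4 (λ m p m′ p′ → m :* p :* (m′ :* p′) := m :* m′ :* (p :* p′)) refl _ _ _ _ ⟩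
            μ T l * μ T l′ * (x ^ toℕ a * x ^ toℕ a′)
              ≈⟨ *-cong e (sym (^-homo-* x (toℕ a) (toℕ a′))) ⟩
            μ T l″ * x ^ (toℕ a ℕ.+ toℕ a′)
              ≈⟨ e′ ⟩
            μ′ k ∎)
      ; torsion = λ k →
          let l , a = remQuot {size T} N k in
          trans (^-distrib-* (μ T l) (x ^ toℕ a) N)
            (trans (*-cong (torsion T l)
              (trans (^-assocʳ x (toℕ a) N)
                (trans (^-congʳ x (ℕ.*-comm (toℕ a) N)) (power-torsion x N x^N≈1 (toℕ a)))))
              (*-identityˡ 1#))
      }

    adjoin-old : ∀ {y} → Member T y → Member adjoin y
    adjoin-old (l , e) = let k , e′ = member′ l 0 in k , trans e (trans (sym (*-identityʳ _)) e′)

    adjoin-new : Member adjoin x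
    adjoin-new = let k , e = member′ (proj₁ (one T)) 1 in
      k , trans (trans (sym (*-identityˡ x)) (*-cong (sym (proj₂ (one T))) (sym (*-identityʳ x)))) e

  generated : ∀ {N} {{_ : ℕ.NonZero N}} {n} (ζ : Fin n → Carrier) → (∀ i → ζ i ^ N ≈ 1#) →
              Σ (TorsionMonoid N) λ T → ∀ i → Member T (ζ i)
  generated {N} {zero}  ζ tors = trivialMonoid N , λ ()
  generated {N} {suc n} ζ tors = adjoin T (ζ zero) (tors zero) , λ where
      zero    → adjoin-new T (ζ zero) (tors zero)
      (suc i) → adjoin-old T (ζ zero) (tors zero) (mem i)
    where
    rest = generated (ζ ∘ suc) (tors ∘ suc)
    T = proj₁ rest
    mem = proj₂ rest

  torsion-coprime : ∀ {x m n} → Coprime m n → x ^ m ≈ 1# → x ^ n ≈ 1# → x ≈ 1#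
  torsion-coprime {x} {m} {n} cop xm xn = identity (coprime-Bézout cop)
    where
    cancel : ∀ a b k l → x ^ a ≈ 1# → x ^ b ≈ 1# → 1 ℕ.+ k ℕ.* a ≡ l ℕ.* b → x ≈ 1#
    cancel a b k l xa xb eq = begin
      x                    ≈⟨ *-identityʳ x ⟨
      x * 1#               ≈⟨ *-congˡ (power-torsion x a xa k) ⟨
      x * x ^ (a ℕ.* k)    ≡⟨ ≡.cong (λ e → x * x ^ e) (ℕ.*-comm a k) ⟩
      x ^ (1 ℕ.+ k ℕ.* a)  ≡⟨ ≡.cong (x ^_) (≡.trans eq (ℕ.*-comm l b)) ⟩
      x ^ (b ℕ.* l)        ≈⟨ power-torsion x b xb l ⟩
      1#                   ∎
    identity : Bézout.Identity 1 m n → x ≈ 1#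
    identity (Bézout.+- k l eq) = cancel n m l k xn xm eq
    identity (Bézout.-+ k l eq) = cancel m n k l xm xn eq

  torsion-regular : ∀ {x} n → n ≢ 0 → x ^ n ≈ 1# → Regular x
  torsion-regular zero    n≢0 h = contradiction ≡.refl n≢0
  torsion-regular (suc n) n≢0 h =
    regular-factor (regular-cong (sym h) λ y e → trans (sym (*-identityˡ y)) e)

  sum-single : ∀ {n} (f : Fin n → Carrier) i → (∀ j → j ≢ i → f j ≈ 0#) → sum f ≈ f i
  sum-single {suc n} f zero    h = trans (+-congˡ (sum-≈0 {n} λ j → h (suc j) λ ())) (+-identityʳ _)
  sum-single {suc n} f (suc i) h = trans
    (+-cong (h zero λ ()) (sum-single (f ∘ suc) i (λ j j≢i → h (suc j) (j≢i ∘ Fin.suc-injective)))) (+-identityˡ _)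

  sum-if : ∀ {n} → (Fin n → Bool) → (Fin n → Carrier) → Carrier
  sum-if I x = sum (λ i → if I i then x i else 0#)

  -- Removing a prime from the common exponent.

  module RemovePrime {p M : ℕ} (p-prime : Prime p) (M≢0 : M ≢ 0) {n : ℕ}
    (z : Fin n → ℤ) (ζ : Fin n → Carrier) (tors : ∀ i → ζ i ^ (p ℕ.* M) ≈ 1#)
    (vanish : sum (λ i → ι (z i) * ζ i) ≈ 0#) (removable : p ∣ M ⊎ n ℕ.< p)
    where
    private
      N = p ℕ.* M
      p≢0 : p ≢ 0
      p≢0 ≡.refl = ¬prime[0] p-prime
      N≢0 : N ≢ 0
      N≢0 h = [ p≢0 , M≢0 ]′ (ℕ.m*n≡0⇒m≡0∨n≡0 p h)
      instance N-nonZero = ℕ.≢-nonZero N≢0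

      gen = generated ζ tors
      T = proj₁ gen
      mζ = proj₂ gen

      ω : Fin n → Carrier
      ω i = ζ i ^ M

      mω : ∀ i → Member T (ω i)
      mω i = member-^ T (mζ i) M

      ω^p≈1 : ∀ i → ω i ^ p ≈ 1#
      ω^p≈1 i = trans (^-assocʳ (ζ i) M p) (trans (^-congʳ (ζ i) (ℕ.*-comm M p)) (tors i))

      -- These are exponents congruent to 1 modulo `M`: passing from `ζ i` to its power `exponent t`
      -- multiplies it by `ω i ^ t`.
      exponent : ℕ → ℕ
      exponent t = suc (t ℕ.* M)

      S : ℕ → Carrier
      S t = sum {n} (λ i → ι (z i) * ζ i ^ exponent t)

      S≈ : ∀ t → S t ≈ sum {n} (λ i → ι (z i) * ζ i * ω i ^ t)
      S≈ t = sum-cong-≋ {n} λ i → trans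
        (*-congˡ (*-congˡ (trans (^-congʳ (ζ i) (ℕ.*-comm t M)) (sym (^-assocʳ (ζ i) M t)))))
        (sym (*-assoc _ _ _))

      S≈0 : ∀ t → NoCommonPrime (exponent t) N → S t ≈ 0#
      S≈0 t ⊥N = conjugate T N≢0 z mζ (λ ()) ⊥N vanish

      coprime-to-M : ∀ {q} t → Prime q → q ∣ exponent t → q ∤ M
      coprime-to-M {q} t q-prime q∣ q∣M = prime∤1 q-prime
        (∣m+n∣m⇒∣n (≡.subst (q ∣_) (ℕ.+-comm 1 (t ℕ.* M)) q∣) (∣n⇒∣m*n t q∣M))

      -- As `1 + t M` is prime to `M`, the only prime it can share with `p M` is `p`, and only when
      -- `p ∤ M`.
      S≈0-unless : ∀ t → ¬ (p ∤ M × p ∣ exponent t) → S t ≈ 0#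
      S≈0-unless t h = S≈0 t λ {q} q-prime q∣ q∣N → case q-prime q∣ (euclidsLemma p M q-prime q∣N)
        where
        case : ∀ {q} → Prime q → q ∣ exponent t → q ∣ p ⊎ q ∣ M → ⊥
        case q-prime q∣ (inj₂ q∣M) = coprime-to-M t q-prime q∣ q∣M
        case q-prime q∣ (inj₁ q∣p) with ≡.refl ← prime∣prime⇒≡ q-prime p-prime q∣p =
          h (coprime-to-M t q-prime q∣ , q∣)

      -- For `u = 1` this selects the terms with `ζ i ^ M = 1`, which are to be kept; other `u`
      -- serve to produce an empty selection.
      isInverse : ∀ {u} → Member T u → Fin n → Bool
      isInverse mu i with one-or-regular T (member-* T mu (mω i))
      ... | inj₁ _ = true
      ... | inj₂ _ = false

      true⇒inverse : ∀ {u} (mu : Member T u) i → isInverse mu i ≡ true → u * ω i ≈ 1#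
      true⇒inverse mu i h with one-or-regular T (member-* T mu (mω i))
      ... | inj₁ e = e
      ... | inj₂ _ with () ← h

      inverse⇒true : ∀ {u} (mu : Member T u) i → u * ω i ≈ 1# → isInverse mu i ≡ true
      inverse⇒true mu i h with one-or-regular T (member-* T mu (mω i))
      ... | inj₁ _ = ≡.refl
      ... | inj₂ r = contradiction (x≈y⇒x∙y⁻¹≈ε h) (regular-≉0 r)

      inverse-sum : ∀ {u} (mu : Member T u) → u ^ p ≈ 1# → ∀ i (y : Carrier) →
        y * sum {p} (λ t → (u * ω i) ^ toℕ t) ≈ ν p * (if isInverse mu i then y else 0#)
      inverse-sum {u} mu u^p≈1 i y with one-or-regular T (member-* T mu (mω i))
      ... | inj₁ e = trans (*-congˡ (trans (sum-cong-≋ {p} λ t → trans (^-congˡ (toℕ t) e) (1^n≈1 (toℕ t)))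
                       (trans (sum-replicate p) (trans (·≈ν* p 1#) (*-identityʳ _))))) (*-comm _ _)
      ... | inj₂ r = trans (*-congˡ (r _ (trans (geometric-sum (u * ω i) p) (x≈y⇒x∙y⁻¹≈ε
                       (trans (^-distrib-* u (ω i) p) (trans (*-cong u^p≈1 (ω^p≈1 i)) (*-identityˡ 1#)))))))
                       (trans (zeroʳ y) (sym (zeroʳ _)))

      term : Fin n → Carrier
      term i = ι (z i) * ζ i

      -- Orthogonality of the characters t ↦ (u ωᵢ)ᵗ of ℤ/p.
      average : ∀ {u} (mu : Member T u) → u ^ p ≈ 1# →
        sum {p} (λ t → u ^ toℕ t * S (toℕ t)) ≈ ν p * sum-if (isInverse mu) term
      average {u} mu u^p≈1 = begin
        sum {p} (λ t → u ^ toℕ t * S (toℕ t))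
          ≈⟨ sum-cong-≋ {p} (λ t → trans (*-congˡ (S≈ (toℕ t))) (*-distribˡ-sum {n} (u ^ toℕ t) _)) ⟩
        sum {p} (λ t → sum {n} (λ i → u ^ toℕ t * (term i * ω i ^ toℕ t)))
          ≈⟨ ∑-comm {p} {n} (λ t i → u ^ toℕ t * (term i * ω i ^ toℕ t)) ⟩
        sum {n} (λ i → sum {p} (λ t → u ^ toℕ t * (term i * ω i ^ toℕ t)))
          ≈⟨ sum-cong-≋ {n} (λ i → sum-cong-≋ {p} λ t → trans
               (solve 3 (λ a b c → a :* (b :* c) := b :* (a :* c)) refl (u ^ toℕ t) (term i) (ω i ^ toℕ t))
               (*-congˡ (sym (^-distrib-* u (ω i) (toℕ t))))) ⟩
        sum {n} (λ i → sum {p} (λ t → term i * (u * ω i) ^ toℕ t))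
          ≈⟨ sum-cong-≋ {n} (λ i → *-distribˡ-sum {p} (term i) (λ t → (u * ω i) ^ toℕ t)) ⟨
        sum {n} (λ i → term i * sum {p} (λ t → (u * ω i) ^ toℕ t))
          ≈⟨ sum-cong-≋ {n} (λ i → inverse-sum mu u^p≈1 i (term i)) ⟩
        sum {n} (λ i → ν p * (if isInverse mu i then term i else 0#))
          ≈⟨ *-distribˡ-sum {n} (ν p) _ ⟨
        ν p * sum-if (isInverse mu) term ∎

      m1 : Member T 1#
      m1 = member-1 T

      νp-regular : Regular (ν p)
      νp-regular = ι-regular (+ p) (λ h → p≢0 (ℤ.+-injective h))

      all-zero : (∀ (t : Fin p) → S (toℕ t) ≈ 0#) → sum-if (isInverse m1) term ≈ 0#
      all-zero S≈0 = νp-regular _ (trans (sym (average m1 (1^n≈1 p)))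
        (sum-≈0 {p} λ t → trans (*-congˡ (S≈0 t)) (zeroʳ _)))

      if-cong : ∀ {I : Fin n → Bool} {b} → (∀ i → I i ≡ b) → sum-if I term ≈ (if b then sum {n} term else 0#)
      if-cong {b = true}  h = sum-cong-≋ {n} λ i → reflexive (≡.cong (if_then term i else 0#) (h i))
      if-cong {b = false} h = sum-≈0 {n} λ i → reflexive (≡.cong (if_then term i else 0#) (h i))

      -- Two bad indices `t′ < t < p` would make `p` divide `(t - t′) M`, hence `t - t′`, which is
      -- positive and less than `p`.
      index-unique : p ∤ M → ∀ {t t′} → t ℕ.< p → p ∣ exponent t → p ∣ exponent t′ → t ℕ.≤ t′
      index-unique p∤M {t} {t′} t<p h h′ with t ℕ.≤? t′
      ... | yes t≤t′ = t≤t′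
      ... | no  t≰t′ = contradiction
          (ℕ.<-≤-trans (ℕ.≤-<-trans (ℕ.m∸n≤m t t′) t<p) (∣⇒≤ {{nz}} p∣d)) (ℕ.<-irrefl ≡.refl)
        where
        t′<t = ℕ.≰⇒> t≰t′
        nz = ℕ.>-nonZero (ℕ.m<n⇒0<n∸m t′<t)
        split : exponent t ≡ exponent t′ ℕ.+ (t ℕ.∸ t′) ℕ.* M
        split = ≡.cong suc (≡.trans (≡.cong (ℕ._* M) (≡.sym (ℕ.m+[n∸m]≡n (ℕ.<⇒≤ t′<t))))
                                    (ℕ.*-distribʳ-+ M t′ (t ℕ.∸ t′)))
        p∣d : p ∣ t ℕ.∸ t′
        p∣d with euclidsLemma (t ℕ.∸ t′) M p-prime (∣m+n∣m⇒∣n (≡.subst (p ∣_) split h) h′)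
        ... | inj₁ d = d
        ... | inj₂ d = contradiction d p∤M

      -- If p ∤ M, the conjugate at the index t₀ with p ∣ 1 + t₀M is not available. But
      -- if u is a p-th root of unity different from all ωᵢ⁻¹, then the average against
      -- u is an empty sum, so uᵗ⁰ S t₀ = 0. As n < p, some power of an ωᵢ ≠ 1 is such a u.
      module OneBadIndex (p∤M : p ∤ M) (n<p : n ℕ.< p) (t₀ : Fin p) (bad : p ∣ exponent (toℕ t₀)) where
        good : ∀ t → t ≢ t₀ → S (toℕ t) ≈ 0#
        good t t≢t₀ = S≈0-unless (toℕ t) λ (_ , h) → t≢t₀ (toℕ-injective
          (ℕ.≤-antisym (index-unique p∤M (toℕ<n t) h bad) (index-unique p∤M (toℕ<n t₀) bad h)))

        avoided⇒zero : ∀ {u} (mu : Member T u) → u ^ p ≈ 1# → (∀ i → isInverse mu i ≡ false) →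
                       ∀ t → S (toℕ t) ≈ 0#
        avoided⇒zero {u} mu u^p≈1 none t with t Fin.≟ t₀
        ... | no t≢t₀ = good t t≢t₀
        ... | yes ≡.refl = regular-^ (torsion-regular p p≢0 u^p≈1) (toℕ t₀) _ (begin
          u ^ toℕ t₀ * S (toℕ t₀)
            ≈⟨ sum-single (λ t → u ^ toℕ t * S (toℕ t)) t₀ (λ t t≢t₀ → trans (*-congˡ (good t t≢t₀)) (zeroʳ _)) ⟨
          sum {p} (λ t → u ^ toℕ t * S (toℕ t))
            ≈⟨ average mu u^p≈1 ⟩
          ν p * sum-if (isInverse mu) term
            ≈⟨ trans (*-congˡ (if-cong none)) (zeroʳ _) ⟩
          0# ∎)

        -- Otherwise every `u^l` with `l < p` is inverse to some `ω i`. As `n < p`, two exponents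
        -- `l < l′` share the same `i`, so `u^(l′ - l) = 1`; together with `u^p = 1` this forces
        -- `u = 1`.
        powers-avoid : ∀ {u} (mu : Member T u) → u ^ p ≈ 1# → ¬ u ≈ 1# →
          Σ (Fin p) λ l → ∀ i → isInverse (member-^ T mu (toℕ l)) i ≡ false
        powers-avoid {u} mu u^p≈1 u≉1 with any? (λ l → all? (λ i → isInverse (member-^ T mu (toℕ l)) i ≟ᵇ false))
        ... | yes found = found
        ... | no  none  = ⊥-elim (collision (pigeonhole n<p (proj₁ ∘ hit)))
          where
          hit : ∀ l → Σ (Fin n) λ i → u ^ toℕ l * ω i ≈ 1#
          hit l with any? (λ i → isInverse (member-^ T mu (toℕ l)) i ≟ᵇ true)
          ... | yes (i , h) = i , true⇒inverse (member-^ T mu (toℕ l)) i h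
          ... | no  h = contradiction (l , λ i → ¬-not (λ e → h (i , e))) none
          collision : (∃₂ λ l l′ → l Fin.< l′ × proj₁ (hit l) ≡ proj₁ (hit l′)) → ⊥
          collision (l , l′ , l<l′ , eq) = u≉1 (torsion-coprime
            (prime⇒coprime p-prime {{ℕ.>-nonZero (ℕ.m<n⇒0<n∸m l<l′)}}
              (ℕ.≤-<-trans (ℕ.m∸n≤m (toℕ l′) (toℕ l)) (toℕ<n l′)))
            u^p≈1 (begin
              u ^ d
                ≈⟨ *-identityˡ _ ⟨
              1# * u ^ d
                ≈⟨ *-congʳ (proj₂ (hit l)) ⟨
              u ^ toℕ l * ω i * u ^ d
                ≈⟨ solve 3 (λ a b c → a :* b :* c := a :* c :* b) refl (u ^ toℕ l) (ω i) (u ^ d) ⟩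
              u ^ toℕ l * u ^ d * ω i
                ≈⟨ *-congʳ (^-homo-* u (toℕ l) d) ⟨
              u ^ (toℕ l ℕ.+ d) * ω i
                ≡⟨ ≡.cong₂ (λ k j → u ^ k * ω j) (ℕ.m+[n∸m]≡n (ℕ.<⇒≤ l<l′)) eq ⟩
              u ^ toℕ l′ * ω (proj₁ (hit l′))
                ≈⟨ proj₂ (hit l′) ⟩
              1# ∎))
            where
            d = toℕ l′ ℕ.∸ toℕ l
            i = proj₁ (hit l)

        class-vanishes : sum-if (isInverse m1) term ≈ 0#
        class-vanishes with any? (λ i → isInverse m1 i ≟ᵇ false)
        -- Here all `ω i` are 1, and the class is the entire vanishing sum.
        ... | no none = trans (if-cong (λ i → ¬-not (λ h → none (i , h)))) vanish
        ... | yes (i , h) = let l , avoids = powers-avoid (mω i) (ω^p≈1 i) ω≉1 in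
          all-zero (avoided⇒zero (member-^ T (mω i) (toℕ l))
            (trans (^-assocʳ (ω i) (toℕ l) p)
              (trans (^-congʳ (ω i) (ℕ.*-comm (toℕ l) p)) (power-torsion (ω i) p (ω^p≈1 i) (toℕ l)))) avoids)
          where
          ω≉1 : ¬ ω i ≈ 1#
          ω≉1 e with () ← ≡.trans (≡.sym (inverse⇒true m1 i (trans (*-identityˡ _) e))) h

    class : Fin n → Bool
    class = isInverse m1

    class-true : ∀ i → class i ≡ true → ζ i ^ M ≈ 1#
    class-true i h = trans (sym (*-identityˡ _)) (true⇒inverse m1 i h)

    true-class : ∀ i → ζ i ≈ 1# → class i ≡ true
    true-class i h = inverse⇒true m1 i (trans (*-identityˡ _) (trans (^-congˡ M h) (1^n≈1 M)))

    -- If `p ∣ M`, all `p` conjugates vanish. Otherwise they vanish except possibly at a solution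
    -- `t` of `1 + t M ≡ 0` modulo `p`, which is found by search; in that case `removable` leaves
    -- only `n < p`.
    class-sum≈0 : sum-if class (λ i → ι (z i) * ζ i) ≈ 0#
    class-sum≈0 with p ∣? M | any? (λ (t : Fin p) → p ∣? exponent (toℕ t))
    ... | yes p∣M | _ = all-zero λ t → S≈0-unless (toℕ t) λ (p∤M , _) → p∤M p∣M
    ... | no  p∤M | no none = all-zero λ t → S≈0-unless (toℕ t) λ (_ , h) → none (t , h)
    ... | no  p∤M | yes (t₀ , bad) = OneBadIndex.class-vanishes p∤M
      ([ (λ p∣M → contradiction p∣M p∤M) , id ]′ removable) t₀ bad

  -- Descent to the primorial.

  record Splitting {n} (z : Fin n → ℤ) (ζ : Fin n → Carrier) : Set (c Level.⊔ ℓ) where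
    field
      part         : Fin n → Bool
      part-sum≈0   : sum-if part (λ i → ι (z i) * ζ i) ≈ 0#
      part-torsion : ∀ i → part i ≡ true → ζ i ^ primorial n ≈ 1#
      part-one     : ∀ i → ζ i ≈ 1# → part i ≡ true

  abstract
    -- Each removable prime shrinks the common exponent and restricts the sum to a vanishing class,
    -- until the exponent divides the primorial. `part-one` is carried through the induction because
    -- a term with root 1 has to survive every restriction.
    splitting : ∀ {n} N → N ≢ 0 → (z : Fin n → ℤ) (ζ : Fin n → Carrier) → (∀ i → ζ i ^ N ≈ 1#) →
                sum (λ i → ι (z i) * ζ i) ≈ 0# → Splitting z ζ
    splitting {n} = <-rec _ go
      where
      P : ℕ → Set (c Level.⊔ ℓ)
      P N = N ≢ 0 → (z : Fin n → ℤ) (ζ : Fin n → Carrier) → (∀ i → ζ i ^ N ≈ 1#) →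
            sum (λ i → ι (z i) * ζ i) ≈ 0# → Splitting z ζ
      go : ∀ N → (∀ {M} → M ℕ.< N → P M) → P N
      go N rec N≢0 z ζ tors vanish with ∣primorial-or-removable-prime n N N≢0
      ... | inj₁ (divides t eq) = record
        { part = λ _ → true
        ; part-sum≈0 = vanish
        ; part-torsion = λ i _ → trans (^-congʳ (ζ i) (≡.trans eq (ℕ.*-comm t N))) (power-torsion (ζ i) N (tors i) t)
        ; part-one = λ _ _ → ≡.refl
        }
      ... | inj₂ (p , M , p-prime , ≡.refl , removable) = record
        { part = λ i → class i ∧ part i
        ; part-sum≈0 = trans (sum-cong-≋ {n} λ i → sym (select-∧ i (class i) (part i))) part-sum≈0
        ; part-torsion = λ i → torsion′ i (class i) ≡.refl (part i) ≡.refl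
        ; part-one = λ i h → ≡.cong₂ _∧_ (true-class i h)
            (part-one i (trans (reflexive (≡.cong (if_then ζ i else 1#) (true-class i h))) h))
        }
        where
        M≢0 : M ≢ 0
        M≢0 ≡.refl = N≢0 (ℕ.*-zeroʳ p)
        M<N : M ℕ.< p ℕ.* M
        M<N = ≡.subst (M ℕ.<_) (ℕ.*-comm M p)
          (ℕ.m<m*n M p {{ℕ.≢-nonZero M≢0}} (ℕ.nonTrivial⇒n>1 p {{prime⇒nonTrivial p-prime}}))
        open RemovePrime p-prime M≢0 z ζ tors vanish removable
        -- The index set stays fixed: dropped terms get coefficient 0 and root 1.
        z′ : Fin n → ℤ
        z′ i = if class i then z i else 0ℤ
        ζ′ : Fin n → Carrier
        ζ′ i = if class i then ζ i else 1#
        select : ∀ i b → ι (if b then z i else 0ℤ) * (if b then ζ i else 1#) ≈ (if b then ι (z i) * ζ i else 0#)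
        select i true  = refl
        select i false = trans (*-congʳ ι-0) (zeroˡ _)
        select-∧ : ∀ i b b′ → (if b′ then ι (if b then z i else 0ℤ) * (if b then ζ i else 1#) else 0#)
                            ≈ (if b ∧ b′ then ι (z i) * ζ i else 0#)
        select-∧ i true  b′    = refl
        select-∧ i false true  = select i false
        select-∧ i false false = refl
        tors′ : ∀ i b → class i ≡ b → (if b then ζ i else 1#) ^ M ≈ 1#
        tors′ i true  h = class-true i h
        tors′ i false _ = 1^n≈1 M
        open Splitting (rec M<N M≢0 z′ ζ′ (λ i → tors′ i (class i) ≡.refl)
          (trans (sum-cong-≋ {n} λ i → select i (class i)) class-sum≈0))
        torsion′ : ∀ i b → class i ≡ b → ∀ b′ → part i ≡ b′ → b ∧ b′ ≡ true → ζ i ^ primorial n ≈ 1#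
        torsion′ i true  h true h′ _ =
          trans (^-congˡ (primorial n) (reflexive (≡.cong (if_then ζ i else 1#) (≡.sym h)))) (part-torsion i h′)
        torsion′ i false h b′ h′ ()

-- Rational coefficients

fromℤ : ℤ → ℚ
fromℤ n = mkℚ n 0 (Coprimality.sym (Coprimality.1-coprimeTo ℤ.∣ n ∣))

fromℤ-+ : ∀ m n → fromℤ (m ℤ.+ n) ≡ fromℤ m ℚ.+ fromℤ n
fromℤ-+ m n = ℚ.toℚᵘ-injective (ℚᵘ.≃-trans
  (*≡* (≡.cong (ℤ._* 1ℤ) (≡.cong₂ ℤ._+_ (≡.sym (ℤ.*-identityʳ m)) (≡.sym (ℤ.*-identityʳ n)))))
  (ℚᵘ.≃-sym (ℚ.toℚᵘ-homo-+ (fromℤ m) (fromℤ n))))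

fromℤ-* : ∀ m n → fromℤ (m ℤ.* n) ≡ fromℤ m ℚ.* fromℤ n
fromℤ-* m n = ℚ.toℚᵘ-injective (ℚᵘ.≃-sym (ℚ.toℚᵘ-homo-* (fromℤ m) (fromℤ n)))

fromℤ-neg : ∀ n → fromℤ (ℤ.- n) ≡ ℚ.- fromℤ n
fromℤ-neg n = ℚ.toℚᵘ-injective (ℚᵘ.≃-sym (ℚ.toℚᵘ-homo‿- (fromℤ n)))

fromℤ-hom : RingMorphisms.IsRingHomomorphism ℤ-ring ℚ-ring fromℤ
fromℤ-hom = record
  { isSemiringHomomorphism = record
    { isNearSemiringHomomorphism = record
      { +-isMonoidHomomorphism = record
        { isMagmaHomomorphism = record
          { isRelHomomorphism = record { cong = ≡.cong fromℤ }
          ; homo = fromℤ-+ }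
        ; ε-homo = ≡.refl }
      ; *-homo = fromℤ-* }
    ; 1#-homo = ≡.refl }
  ; -‿homo = fromℤ-neg }

fromℤ-inverse : ∀ n → n ≢ 0ℤ → ∃[ r ] fromℤ n ℚ.* r ≡ 1ℚ
fromℤ-inverse n n≢0 = ℚ.1/ fromℤ n , ℚ.*-inverseʳ (fromℤ n)
  where instance nonZero = ℚ.≢-nonZero {fromℤ n} (n≢0 ∘ ≡.cong ↥_)

denominator-clears : ∀ c → fromℤ (↧ c) ℚ.* c ≡ fromℤ (↥ c)
denominator-clears c@record{} = ℚ.toℚᵘ-injective (ℚᵘ.≃-trans (ℚ.toℚᵘ-homo-* (fromℤ (↧ c)) c)
  (*≡* (≡.trans (ℤ.*-identityʳ (↧ c ℤ.* ↥ c)) (≡.trans (ℤ.*-comm (↧ c) (↥ c))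
    (≡.cong (λ d → ↥ c ℤ.* (+ d)) (≡.sym (ℕ.*-identityˡ (ℚ.↧ₙ c))))))))

common-denominator : ∀ {n} (c : Fin n → ℚ) →
  Σ ℤ λ D → D ≢ 0ℤ × Σ (Fin n → ℤ) λ z → ∀ i → fromℤ D ℚ.* c i ≡ fromℤ (z i)
common-denominator {zero}  c = 1ℤ , (λ ()) , (λ ()) , λ ()
common-denominator {suc n} c =
  let D , D≢0 , z , eq = common-denominator (c ∘ suc)
      d = ↧ c zero
      z′ = λ where
        zero    → D ℤ.* ↥ c zero
        (suc i) → d ℤ.* z i
  in D ℤ.* d
   , (λ h → [ D≢0 , (λ ()) ]′ (ℤ.i*j≡0⇒i≡0∨j≡0 D h))
   , z′
   , λ where
     zero → begin
       fromℤ (D ℤ.* d) ℚ.* c zero           ≡⟨ ≡.cong (ℚ._* c zero) (fromℤ-* D d) ⟩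
       (fromℤ D ℚ.* fromℤ d) ℚ.* c zero     ≡⟨ ℚ.*-assoc (fromℤ D) (fromℤ d) (c zero) ⟩
       fromℤ D ℚ.* (fromℤ d ℚ.* c zero)     ≡⟨ ≡.cong (fromℤ D ℚ.*_) (denominator-clears (c zero)) ⟩
       fromℤ D ℚ.* fromℤ (↥ c zero)         ≡⟨ fromℤ-* D (↥ c zero) ⟨
       fromℤ (D ℤ.* ↥ c zero)               ∎
     (suc i) → begin
       fromℤ (D ℤ.* d) ℚ.* c (suc i)        ≡⟨ ≡.cong (λ e → fromℤ e ℚ.* c (suc i)) (ℤ.*-comm D d) ⟩
       fromℤ (d ℤ.* D) ℚ.* c (suc i)        ≡⟨ ≡.cong (ℚ._* c (suc i)) (fromℤ-* d D) ⟩
       (fromℤ d ℚ.* fromℤ D) ℚ.* c (suc i)  ≡⟨ ℚ.*-assoc (fromℤ d) (fromℤ D) (c (suc i)) ⟩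
       fromℤ d ℚ.* (fromℤ D ℚ.* c (suc i))  ≡⟨ ≡.cong (fromℤ d ℚ.*_) (eq i) ⟩
       fromℤ d ℚ.* fromℤ (z i)              ≡⟨ fromℤ-* d (z i) ⟨
       fromℤ (d ℤ.* z i)                    ∎
  where open ≡.≡-Reasoning

-- Two rational combinations of roots of unity with the same value.

module RationalSums {c ℓ} (R : CommutativeRing c ℓ)
  (κ : ℚ → CommutativeRing.Carrier R)
  (κ-hom : RingMorphisms.IsRingHomomorphism ℚ-ring (CommutativeRing.rawRing R) κ)
  (1≉0 : RingSum.Nontrivial R) (reduced : RingSum.Reduced R) (local : RingSum.Local R)
  where
  open RingSum R
  module κ = RingMorphisms.IsRingHomomorphism κ-hom

  ι : ℤ → Carrier
  ι = κ ∘ fromℤ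

  ι-hom : RingMorphisms.IsRingHomomorphism ℤ-ring (CommutativeRing.rawRing R) ι
  ι-hom = Composition.isRingHomomorphism trans fromℤ-hom κ-hom

  ι-inverse : ∀ n → n ≢ 0ℤ → Σ Carrier λ r → ι n * r ≈ 1#
  ι-inverse n n≢0 = let r , e = fromℤ-inverse n n≢0 in
    κ r , trans (sym (κ.*-homo (fromℤ n) r)) (trans (κ.⟦⟧-cong e) κ.1#-homo)

  open Integers.Solver R ι ι-hom using (solve; _:+_; _:*_; _:-_; :-_; _:=_)
  open TorsionSums R ι ι-hom ι-inverse 1≉0 reduced local using (ι-regular; sum-if; Splitting; splitting)

  Torsion : Carrier → Set ℓ
  Torsion x = Σ ℕ λ n → n ≢ 0 × x ^ n ≈ 1#

  torsion-* : ∀ {x y} → Torsion x → Torsion y → Torsion (x * y)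
  torsion-* {x} {y} (m , m≢0 , x^m) (n , n≢0 , y^n) =
    m ℕ.* n , (λ h → [ m≢0 , n≢0 ]′ (ℕ.m*n≡0⇒m≡0∨n≡0 m h)) , (begin
    (x * y) ^ (m ℕ.* n)
      ≈⟨ ^-distrib-* x y (m ℕ.* n) ⟩
    x ^ (m ℕ.* n) * y ^ (m ℕ.* n)
      ≈⟨ *-cong (power-torsion x m x^m n) (trans (^-congʳ y (ℕ.*-comm m n)) (power-torsion y n y^n m)) ⟩
    1# * 1#
      ≈⟨ *-identityˡ 1# ⟩
    1# ∎)

  torsion-inverse : ∀ {x y} → x * y ≈ 1# → Torsion x → Torsion y
  torsion-inverse {x} {y} xy≈1 (n , n≢0 , x^n) = n , n≢0 , (begin
    y ^ n            ≈⟨ *-identityˡ _ ⟨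
    1# * y ^ n       ≈⟨ *-congʳ x^n ⟨
    x ^ n * y ^ n    ≈⟨ ^-distrib-* x y n ⟨
    (x * y) ^ n      ≈⟨ ^-congˡ n xy≈1 ⟩
    1# ^ n           ≈⟨ 1^n≈1 n ⟩
    1#               ∎)

  common-exponent : ∀ {n} (x : Fin n → Carrier) → (∀ i → Torsion (x i)) →
                    Σ ℕ λ N → N ≢ 0 × ∀ i → x i ^ N ≈ 1#
  common-exponent {zero}  x tors = 1 , (λ ()) , λ ()
  common-exponent {suc n} x tors =
    let m , m≢0 , x₀^m = tors zero
        N , N≢0 , x^N  = common-exponent (x ∘ suc) (tors ∘ suc)
    in m ℕ.* N , (λ h → [ m≢0 , N≢0 ]′ (ℕ.m*n≡0⇒m≡0∨n≡0 m h)) , λ where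
      zero    → power-torsion (x zero) m x₀^m N
      (suc i) → trans (^-congʳ (x (suc i)) (ℕ.*-comm m N)) (power-torsion (x (suc i)) N (x^N i) m)

  sum-↑ : ∀ m {n} (f : Fin (m ℕ.+ n) → Carrier) →
          sum f ≈ sum {m} (λ i → f (i ↑ˡ n)) + sum {n} (λ j → f (m ↑ʳ j))
  sum-↑ zero    f = sym (+-identityˡ _)
  sum-↑ (suc m) f = trans (+-congˡ (sum-↑ m (f ∘ suc))) (sym (+-assoc _ _ _))

  module _ {k : ℕ} (c c* : Fin k → ℚ) (ζ ζ* ζ⁻¹ ζ*⁻¹ : Fin k → Carrier)
    (ζ-inverse : ∀ i → ζ⁻¹ i * ζ i ≈ 1#) (ζ*-inverse : ∀ j → ζ* j * ζ*⁻¹ j ≈ 1#)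
    (ζ-torsion : ∀ i → Torsion (ζ i)) (ζ*-torsion : ∀ j → Torsion (ζ* j))
    (same-sum : sum (λ i → κ (c i) * ζ i) ≈ sum (λ j → κ (c* j) * ζ* j))
    (sum*≉0 : ¬ sum (λ j → κ (c* j) * ζ* j) ≈ 0#)
    (subsums≉0 : ∀ J → (∃[ j ] J j ≡ true) → (∃[ j ] J j ≡ false) → ¬ sum-if J (λ j → κ (c* j) * ζ* j) ≈ 0#)
    (j : Fin k)
    where
    private
      w : Fin (k ℕ.+ k) → ℚ
      w = c ++ (ℚ.-_ ∘ c*)

      -- Division by `ζ* j` makes the entry at `k ↑ʳ j` equal to 1, so that `part-one` applies to
      -- it.
      η : Fin (k ℕ.+ k) → Carrier
      η = (λ i → ζ i * ζ*⁻¹ j) ++ (λ i → ζ* i * ζ*⁻¹ j)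

      η-torsion : ∀ l → Torsion (η l)
      η-torsion l with Fin.splitAt k l
      ... | inj₁ i = torsion-* (ζ-torsion i) (torsion-inverse (ζ*-inverse j) (ζ*-torsion j))
      ... | inj₂ i = torsion-* (ζ*-torsion i) (torsion-inverse (ζ*-inverse j) (ζ*-torsion j))

      cleared = common-denominator w
      D = proj₁ cleared
      D≢0 = proj₁ (proj₂ cleared)
      z = proj₁ (proj₂ (proj₂ cleared))

      z≈ : ∀ l → ι (z l) ≈ ι D * κ (w l)
      z≈ l = trans (κ.⟦⟧-cong (≡.sym (proj₂ (proj₂ (proj₂ cleared)) l))) (κ.*-homo (fromℤ D) (w l))

      term : Fin (k ℕ.+ k) → Carrier
      term l = ι (z l) * η l

      x = ι D * ζ*⁻¹ j

      termˡ : ∀ i → term (i ↑ˡ k) ≈ x * (κ (c i) * ζ i)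
      termˡ i = begin
        ι (z (i ↑ˡ k)) * η (i ↑ˡ k)
          ≈⟨ *-cong (z≈ (i ↑ˡ k)) (reflexive (lookup-++ˡ (λ i → ζ i * ζ*⁻¹ j) _ i)) ⟩
        ι D * κ (w (i ↑ˡ k)) * (ζ i * ζ*⁻¹ j)
          ≈⟨ *-congʳ (*-congˡ (κ.⟦⟧-cong (lookup-++ˡ c _ i))) ⟩
        ι D * κ (c i) * (ζ i * ζ*⁻¹ j)
          ≈⟨ solve 4 (λ d c z y → d :* c :* (z :* y) := d :* y :* (c :* z)) refl (ι D) (κ (c i)) (ζ i) (ζ*⁻¹ j) ⟩
        x * (κ (c i) * ζ i) ∎

      termʳ : ∀ i → term (k ↑ʳ i) ≈ - x * (κ (c* i) * ζ* i)
      termʳ i = begin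
        ι (z (k ↑ʳ i)) * η (k ↑ʳ i)
          ≈⟨ *-cong (z≈ (k ↑ʳ i)) (reflexive (lookup-++ʳ (λ i → ζ i * ζ*⁻¹ j) (λ i → ζ* i * ζ*⁻¹ j) i)) ⟩
        ι D * κ (w (k ↑ʳ i)) * (ζ* i * ζ*⁻¹ j)
          ≈⟨ *-congʳ (*-congˡ (trans (κ.⟦⟧-cong (lookup-++ʳ c (ℚ.-_ ∘ c*) i)) (κ.-‿homo (c* i)))) ⟩
        ι D * - κ (c* i) * (ζ* i * ζ*⁻¹ j)
          ≈⟨ solve 4 (λ d c z y → d :* :- c :* (z :* y) := :- (d :* y) :* (c :* z)) refl (ι D) (κ (c* i)) (ζ* i) (ζ*⁻¹ j) ⟩
        - x * (κ (c* i) * ζ* i) ∎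

      vanish : sum term ≈ 0#
      vanish = begin
        sum term
          ≈⟨ sum-↑ k term ⟩
        sum {k} (λ i → term (i ↑ˡ k)) + sum {k} (λ i → term (k ↑ʳ i))
          ≈⟨ +-cong (sum-cong-≋ {k} termˡ) (sum-cong-≋ {k} termʳ) ⟩
        sum {k} (λ i → x * (κ (c i) * ζ i)) + sum {k} (λ i → - x * (κ (c* i) * ζ* i))
          ≈⟨ +-cong (*-distribˡ-sum {k} x _) (*-distribˡ-sum {k} (- x) _) ⟨
        x * sum {k} (λ i → κ (c i) * ζ i) + - x * sum {k} (λ i → κ (c* i) * ζ* i)
          ≈⟨ +-cong (*-congˡ same-sum) (sym (-‿distribˡ-* _ _)) ⟩
        x * sum {k} (λ i → κ (c* i) * ζ* i) + - (x * sum {k} (λ i → κ (c* i) * ζ* i))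
          ≈⟨ -‿inverseʳ _ ⟩
        0# ∎

      exponent = common-exponent η η-torsion

      abstract
        split : Splitting z η
        split = splitting (proj₁ exponent) (proj₁ (proj₂ exponent)) z η (proj₂ (proj₂ exponent)) vanish

      open Splitting split

      J : Fin k → Bool
      J i = part (k ↑ʳ i)

      j∈J : J j ≡ true
      j∈J = part-one (k ↑ʳ j) (trans (reflexive (lookup-++ʳ (λ i → ζ i * ζ*⁻¹ j) (λ i → ζ* i * ζ*⁻¹ j) j)) (ζ*-inverse j))

      -x-regular : Regular (- x)
      -x-regular y h = begin
        y                       ≈⟨ *-identityˡ y ⟨
        1# * y                  ≈⟨ *-congʳ (trans (*-comm (ζ*⁻¹ j) (ζ* j)) (ζ*-inverse j)) ⟨
        ζ*⁻¹ j * ζ* j * y       ≈⟨ solve 3 (λ a b y → a :* b :* y := b :* (a :* y)) refl (ζ*⁻¹ j) (ζ* j) y ⟩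
        ζ* j * (ζ*⁻¹ j * y)     ≈⟨ *-congˡ (ι-regular D D≢0 _ (begin
          ι D * (ζ*⁻¹ j * y)      ≈⟨ solve 3 (λ d a y → d :* (a :* y) := :- (:- (d :* a) :* y)) refl (ι D) (ζ*⁻¹ j) y ⟩
          - (- x * y)             ≈⟨ -‿cong h ⟩
          - 0#                    ≈⟨ -0#≈0# ⟩
          0#                      ∎)) ⟩
        ζ* j * 0#               ≈⟨ zeroʳ _ ⟩
        0#                      ∎

      if-scale : ∀ b {t s} y → t ≈ y * s → (if b then t else 0#) ≈ y * (if b then s else 0#)
      if-scale true  y e = e
      if-scale false y e = sym (zeroʳ y)

      if-cong : ∀ {b b′} {t : Carrier} → b ≡ b′ → (if b then t else 0#) ≈ (if b′ then t else 0#)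
      if-cong ≡.refl = refl

      -- `J` contains `j`. If it misses some index, the hypothesis on proper subsums applies;
      -- otherwise the sum is the full one, which is nonzero as well.
      J-sum≉0 : ¬ sum-if J (λ i → κ (c* i) * ζ* i) ≈ 0#
      J-sum≉0 h with any? (λ i → J i ≟ᵇ false)
      ... | yes i∉J = subsums≉0 J (j , j∈J) i∉J h
      ... | no none = sum*≉0 (trans (sum-cong-≋ {k} λ i →
              if-cong {b′ = J i} {t = κ (c* i) * ζ* i} (≡.sym (¬-not λ e → none (i , e)))) h)

    torsion-ratio : ∃[ i ] (ζ* j * ζ⁻¹ i) ^ primorial (k ℕ.+ k) ≈ 1#
    torsion-ratio with any? (λ i → part (i ↑ˡ k) ≟ᵇ true)
    ... | yes (i , i∈part) = i , (begin
      (ζ* j * ζ⁻¹ i) ^ m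
        ≈⟨ *-identityʳ _ ⟨
      (ζ* j * ζ⁻¹ i) ^ m * 1#
        -- `η (i ↑ˡ k)` is the inverse of the ratio sought, so once its `m`-th power, which is 1, is
        -- multiplied in, the bases cancel.
        ≈⟨ *-congˡ (part-torsion (i ↑ˡ k) i∈part) ⟨
      (ζ* j * ζ⁻¹ i) ^ m * η (i ↑ˡ k) ^ m
        ≈⟨ *-congˡ (^-congˡ m (reflexive (lookup-++ˡ (λ i → ζ i * ζ*⁻¹ j) _ i))) ⟩
      (ζ* j * ζ⁻¹ i) ^ m * (ζ i * ζ*⁻¹ j) ^ m
        ≈⟨ ^-distrib-* _ _ m ⟨
      (ζ* j * ζ⁻¹ i * (ζ i * ζ*⁻¹ j)) ^ m
        ≈⟨ ^-congˡ m (trans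
             (solve 4 (λ a b c d → a :* b :* (c :* d) := a :* d :* (b :* c)) refl (ζ* j) (ζ⁻¹ i) (ζ i) (ζ*⁻¹ j))
             (trans (*-cong (ζ*-inverse j) (ζ-inverse i)) (*-identityˡ 1#))) ⟩
      1# ^ m
        ≈⟨ 1^n≈1 m ⟩
      1# ∎)
      where m = primorial (k ℕ.+ k)
    -- Without a surviving `ζ i`, the vanishing part is `- x` times the subsum over `J`, and `- x`
    -- can be cancelled.
    ... | no none = contradiction (-x-regular _ (begin
      - x * sum-if J (λ i → κ (c* i) * ζ* i)
        ≈⟨ *-distribˡ-sum {k} (- x) _ ⟩
      sum {k} (λ i → - x * (if J i then κ (c* i) * ζ* i else 0#))
        ≈⟨ sum-cong-≋ {k} (λ i → if-scale (J i) (- x) (termʳ i)) ⟨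
      sum {k} (λ i → if J i then term (k ↑ʳ i) else 0#)
        ≈⟨ trans (+-congʳ (sum-≈0 {k} λ i → if-cong {t = term (i ↑ˡ k)} (¬-not (λ h → none (i , h))))) (+-identityˡ _) ⟨
      sum {k} (λ i → if part (i ↑ˡ k) then term (i ↑ˡ k) else 0#) + sum {k} (λ i → if J i then term (k ↑ʳ i) else 0#)
        ≈⟨ sum-↑ k (λ l → if part l then term l else 0#) ⟨
      sum-if part term
        ≈⟨ part-sum≈0 ⟩
      0# ∎)) J-sum≉0

-- Complex numbers

module ℝ-Ring = CommutativeRing ℝ-commutativeRing
module ℂ-Ring = RingSum ℂ-commutativeRing
open ℚSolver.+-*-Solver using (solve; con; _:+_; _:*_; _:-_; :-_; _:=_)

pointwise : ∀ {x y} → (∀ n → seq x n ≡ seq y n) → x ≈ᴿ y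
pointwise {x} {y} eq = mk≈ᴿ λ ε 0<ε → 0 , λ n _ → ≡.subst (ℚ._< ε)
  (≡.sym (≡.trans (≡.cong (λ p → ℚ.∣ p ℚ.- seq y n ∣) (eq n)) (≡.cong ℚ.∣_∣ (ℚ.+-inverseʳ (seq y n))))) 0<ε

fromℚ-hom : RingMorphisms.IsRingHomomorphism ℚ-ring (CommutativeRing.rawRing ℂ-commutativeRing) fromℚ
fromℚ-hom = record
  { isSemiringHomomorphism = record
    { isNearSemiringHomomorphism = record
      { +-isMonoidHomomorphism = record
        { isMagmaHomomorphism = record
          { isRelHomomorphism = record { cong = λ { ≡.refl → ℂ-Ring.refl } }
          ; homo = λ p q → mk≈ᶜ (pointwise λ _ → ≡.refl) (pointwise λ _ → ≡.refl) }
        ; ε-homo = ℂ-Ring.refl }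
      ; *-homo = λ p q → mk≈ᶜ
          (pointwise λ _ → solve 2 (λ p q → p :* q := p :* q :+ :- (con 0ℚ :* con 0ℚ)) ≡.refl p q)
          (pointwise λ _ → solve 2 (λ p q → con 0ℚ := p :* con 0ℚ :+ con 0ℚ :* q) ≡.refl p q) }
    ; 1#-homo = ℂ-Ring.refl }
  ; -‿homo = λ p → mk≈ᶜ (pointwise λ _ → ≡.refl) (pointwise λ _ → ≡.refl) }

1ᶜ≉0ᶜ : ¬ (1ᶜ ≈ᶜ 0ᶜ)
1ᶜ≉0ᶜ h = let N , close = limit (re-≈ h) 1ℚ (ℚ.positive⁻¹ 1ℚ) in
  ℚ.<-irrefl ≡.refl (close N ℕ.≤-refl)

∣p∣*∣p∣≡p*p : ∀ p → ℚ.∣ p ∣ ℚ.* ℚ.∣ p ∣ ≡ p ℚ.* p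
∣p∣*∣p∣≡p*p p with ℚ.∣p∣≡p∨∣p∣≡-p p
... | inj₁ eq rewrite eq = ≡.refl
... | inj₂ eq rewrite eq = solve 1 (λ p → :- p :* :- p := p :* p) ≡.refl p

0≤p*p : ∀ p → 0ℚ ℚ.≤ p ℚ.* p
0≤p*p p = ≡.subst (0ℚ ℚ.≤_) (∣p∣*∣p∣≡p*p p)
  (≡.subst (ℚ._≤ ℚ.∣ p ∣ ℚ.* ℚ.∣ p ∣) (ℚ.*-zeroˡ ℚ.∣ p ∣)
    (ℚ.*-monoʳ-≤-nonNeg ℚ.∣ p ∣ {{ℚ.nonNegative (ℚ.0≤∣p∣ p)}} (ℚ.0≤∣p∣ p)))

*-pos : ∀ {p q} → 0ℚ ℚ.< p → 0ℚ ℚ.< q → 0ℚ ℚ.< p ℚ.* q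
*-pos {p} {q} 0<p 0<q = ℚ.positive⁻¹ (p ℚ.* q) {{ℚ.pos*pos⇒pos p {{ℚ.positive 0<p}} q {{ℚ.positive 0<q}}}}

*-mono-≤ : ∀ {p q r s} → 0ℚ ℚ.≤ r → 0ℚ ℚ.≤ q → p ℚ.≤ q → r ℚ.≤ s → p ℚ.* r ℚ.≤ q ℚ.* s
*-mono-≤ {p} {q} {r} {s} 0≤r 0≤q p≤q r≤s = ℚ.≤-trans
  (ℚ.*-monoʳ-≤-nonNeg r {{ℚ.nonNegative 0≤r}} p≤q)
  (ℚ.*-monoˡ-≤-nonNeg q {{ℚ.nonNegative 0≤q}} r≤s)

p-0≡p : ∀ p → p ℚ.- 0ℚ ≡ p
p-0≡p = solve 1 (λ p → p :- con 0ℚ := p) ≡.refl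

-- The ε-δ pattern common to two arguments: one bounds a square (`δ = ε²`), the other a product
-- whose first factor is at least 1/16 (`δ = ε / 16`).
dominated : ∀ {x y} →
  (∀ ε → 0ℚ ℚ.< ε → Σ ℚ λ δ → 0ℚ ℚ.< δ × Eventually (λ n → ℚ.∣ seq y n ∣ ℚ.< δ → ℚ.∣ seq x n ∣ ℚ.< ε)) →
  y ≈ᴿ 0ᴿ → x ≈ᴿ 0ᴿ
dominated {x} {y} dom y≈0 = mk≈ᴿ λ ε 0<ε →
  let δ , 0<δ , M , f = dom ε 0<ε
      N , g = limit y≈0 δ 0<δ
  in M ℕ.⊔ N , λ n h → ≡.subst (λ p → ℚ.∣ p ∣ ℚ.< ε) (≡.sym (p-0≡p (seq x n)))
       (f n (ℕ.≤-trans (ℕ.m≤m⊔n M N) h)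
         (≡.subst (λ p → ℚ.∣ p ∣ ℚ.< δ) (p-0≡p (seq y n)) (g n (ℕ.≤-trans (ℕ.m≤n⊔m M N) h))))

square-dominated : ∀ {x y} → (∀ n → seq x n ℚ.* seq x n ℚ.≤ seq y n) → y ≈ᴿ 0ᴿ → x ≈ᴿ 0ᴿ
square-dominated {x} {y} x²≤y = dominated λ ε 0<ε → ε ℚ.* ε , *-pos 0<ε 0<ε , 0 , λ n _ y<ε² →
  ℚ.≰⇒> λ ε≤x → ℚ.<-irrefl ≡.refl (ℚ.≤-<-trans
    (ℚ.≤-trans (*-mono-≤ (ℚ.<⇒≤ 0<ε) (ℚ.0≤∣p∣ (seq x n)) ε≤x ε≤x)
      (ℚ.≤-trans (ℚ.≤-reflexive (∣p∣*∣p∣≡p*p (seq x n))) (ℚ.≤-trans (x²≤y n) (p≤∣p∣ (seq y n))))) y<ε²)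
  where
  p≤∣p∣ : ∀ p → p ℚ.≤ ℚ.∣ p ∣
  p≤∣p∣ p with ℚ.≤-total 0ℚ p
  ... | inj₁ 0≤p = ℚ.≤-reflexive (≡.sym (ℚ.0≤p⇒∣p∣≡p 0≤p))
  ... | inj₂ p≤0 = ℚ.≤-trans p≤0 (ℚ.0≤∣p∣ p)

≤+-nonNegʳ : ∀ p {q} → 0ℚ ℚ.≤ q → p ℚ.≤ p ℚ.+ q
≤+-nonNegʳ p {q} 0≤q = ≡.subst (ℚ._≤ p ℚ.+ q) (ℚ.+-identityʳ p) (ℚ.+-monoʳ-≤ p 0≤q)

normᴿ : ℂ → ℝ
normᴿ z = re z *ᴿ re z +ᴿ im z *ᴿ im z

norm≈0⇒≈0 : ∀ {z} → normᴿ z ≈ᴿ 0ᴿ → z ≈ᶜ 0ᶜ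
norm≈0⇒≈0 {z} h = mk≈ᶜ
  (square-dominated (λ n → ≤+-nonNegʳ (seq (re z) n ℚ.* seq (re z) n) (0≤p*p (seq (im z) n))) h)
  (square-dominated (λ n → ℚ.≤-trans
    (≤+-nonNegʳ (seq (im z) n ℚ.* seq (im z) n) (0≤p*p (seq (re z) n)))
    (ℚ.≤-reflexive (ℚ.+-comm (seq (im z) n ℚ.* seq (im z) n) _))) h)

-- Multiplicativity of the norm, `|z²|² = (|z|²)²`, reduces this to squares of reals: first `|z|²`
-- is 0, then both coordinates are.
square≈0⇒≈0 : ∀ z → z *ᶜ z ≈ᶜ 0ᶜ → z ≈ᶜ 0ᶜ
square≈0⇒≈0 z h = norm≈0⇒≈0 (square-dominated (λ n → ℚ.≤-refl) (begin
  normᴿ z *ᴿ normᴿ z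
    ≈⟨ pointwise (λ n → solve 2 (λ a b → (a :* a :+ b :* b) :* (a :* a :+ b :* b) :=
         (a :* a :+ :- (b :* b)) :* (a :* a :+ :- (b :* b)) :+ (a :* b :+ b :* a) :* (a :* b :+ b :* a))
         ≡.refl (seq (re z) n) (seq (im z) n)) ⟩
  re (z *ᶜ z) *ᴿ re (z *ᶜ z) +ᴿ im (z *ᶜ z) *ᴿ im (z *ᶜ z)
    ≈⟨ ℝ-Ring.+-cong (ℝ-Ring.*-cong (re-≈ h) (re-≈ h)) (ℝ-Ring.*-cong (im-≈ h) (im-≈ h)) ⟩
  0ᴿ *ᴿ 0ᴿ +ᴿ 0ᴿ *ᴿ 0ᴿ
    ≈⟨ pointwise (λ _ → ≡.refl) ⟩
  0ᴿ ∎))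
  where open import Relation.Binary.Reasoning.Setoid ℝ-Ring.setoid

¼ : ℚ
¼ = ½ ℚ.* ½

real-cancel : ∀ {x y} → Eventually (λ n → ¼ ℚ.* ¼ ℚ.≤ seq x n) → x *ᴿ y ≈ᴿ 0ᴿ → y ≈ᴿ 0ᴿ
real-cancel {x} {y} (N , lower) = dominated λ ε 0<ε →
  ¼ ℚ.* ¼ ℚ.* ε , *-pos (ℚ.positive⁻¹ (¼ ℚ.* ¼)) 0<ε , N , λ n N≤n xy< →
  ℚ.≰⇒> λ ε≤y → ℚ.<-irrefl ≡.refl (ℚ.≤-<-trans (bound (lower n N≤n) 0<ε ε≤y) xy<)
  where
  bound : ∀ {p q ε} → ¼ ℚ.* ¼ ℚ.≤ p → 0ℚ ℚ.< ε → ε ℚ.≤ ℚ.∣ q ∣ → ¼ ℚ.* ¼ ℚ.* ε ℚ.≤ ℚ.∣ p ℚ.* q ∣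
  bound {p} {q} {ε} lower 0<ε ε≤q = ≡.subst (¼ ℚ.* ¼ ℚ.* ε ℚ.≤_) (≡.sym (≡.trans (ℚ.∣p*q∣≡∣p∣*∣q∣ p q)
      (≡.cong (ℚ._* ℚ.∣ q ∣) (ℚ.0≤p⇒∣p∣≡p 0≤p))))
    (*-mono-≤ (ℚ.<⇒≤ 0<ε) 0≤p lower ε≤q)
    where
    0≤p : 0ℚ ℚ.≤ p
    0≤p = ℚ.≤-trans (ℚ.<⇒≤ (ℚ.positive⁻¹ (¼ ℚ.* ¼))) lower

-- Multiplying `z w = 0` by the conjugate of `z` gives `|z|² w = 0`, and `|z|²` is eventually at
-- least 1/16. This is done coordinate by coordinate.
large-re-regular : ∀ {z} → Eventually (λ n → ¼ ℚ.≤ seq (re z) n) → ℂ-Ring.Regular z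
large-re-regular {z} (N , lower) w zw≈0 = mk≈ᶜ
  (real-cancel norm-lower (begin
    normᴿ z *ᴿ re w
      ≈⟨ pointwise (λ n → solve 4 (λ a b x y → (a :* a :+ b :* b) :* x :=
           a :* (a :* x :+ :- (b :* y)) :+ b :* (a :* y :+ b :* x))
           ≡.refl (seq (re z) n) (seq (im z) n) (seq (re w) n) (seq (im w) n)) ⟩
    re z *ᴿ re (z *ᶜ w) +ᴿ im z *ᴿ im (z *ᶜ w)
      ≈⟨ ℝ-Ring.+-cong (ℝ-Ring.*-congˡ (re-≈ zw≈0)) (ℝ-Ring.*-congˡ (im-≈ zw≈0)) ⟩
    re z *ᴿ 0ᴿ +ᴿ im z *ᴿ 0ᴿ
      ≈⟨ combination-0 ⟩
    0ᴿ ∎))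
  (real-cancel norm-lower (begin
    normᴿ z *ᴿ im w
      ≈⟨ pointwise (λ n → solve 4 (λ a b x y → (a :* a :+ b :* b) :* y :=
           a :* (a :* y :+ b :* x) :+ (:- b) :* (a :* x :+ :- (b :* y)))
           ≡.refl (seq (re z) n) (seq (im z) n) (seq (re w) n) (seq (im w) n)) ⟩
    re z *ᴿ im (z *ᶜ w) +ᴿ (-ᴿ im z) *ᴿ re (z *ᶜ w)
      ≈⟨ ℝ-Ring.+-cong (ℝ-Ring.*-congˡ (im-≈ zw≈0)) (ℝ-Ring.*-congˡ (re-≈ zw≈0)) ⟩
    re z *ᴿ 0ᴿ +ᴿ (-ᴿ im z) *ᴿ 0ᴿ
      ≈⟨ combination-0 ⟩
    0ᴿ ∎))
  where
  open import Relation.Binary.Reasoning.Setoid ℝ-Ring.setoid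
  combination-0 : ∀ {x y} → x *ᴿ 0ᴿ +ᴿ y *ᴿ 0ᴿ ≈ᴿ 0ᴿ
  combination-0 {x} {y} = ℝ-Ring.trans (ℝ-Ring.+-cong (ℝ-Ring.zeroʳ x) (ℝ-Ring.zeroʳ y)) (ℝ-Ring.+-identityˡ 0ᴿ)
  norm-lower : Eventually (λ n → ¼ ℚ.* ¼ ℚ.≤ seq (normᴿ z) n)
  norm-lower = N , λ n N≤n → ℚ.≤-trans
    (*-mono-≤ (ℚ.<⇒≤ (ℚ.positive⁻¹ ¼)) (ℚ.≤-trans (ℚ.<⇒≤ (ℚ.positive⁻¹ ¼)) (lower n N≤n)) (lower n N≤n) (lower n N≤n))
    (≤+-nonNegʳ _ (0≤p*p (seq (im z) n)))

difference-lower : ∀ {p q} → ½ ℚ.≤ p → ℚ.∣ p ℚ.- q ∣ ℚ.< ¼ → ¼ ℚ.≤ q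
difference-lower {p} {q} ½≤p close with ℚ.≤-total ¼ q
... | inj₁ ¼≤q = ¼≤q
... | inj₂ q≤¼ = contradiction (ℚ.≤-<-trans ¼≤p-q (ℚ.≤-<-trans p-q≤ close)) (ℚ.<-irrefl ≡.refl)
  where
  ¼≤p-q : ¼ ℚ.≤ p ℚ.- q
  ¼≤p-q = ℚ.+-mono-≤ ½≤p (ℚ.neg-antimono-≤ q≤¼)
  p-q≤ : p ℚ.- q ℚ.≤ ℚ.∣ p ℚ.- q ∣
  p-q≤ = ℚ.≤-reflexive (≡.sym (ℚ.0≤p⇒∣p∣≡p (ℚ.≤-trans (ℚ.<⇒≤ (ℚ.positive⁻¹ ¼)) ¼≤p-q)))

-- A rational approximation of `re z` with error below 1/4 is compared with 1/2, so that `re z` or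
-- `1 - re z` is eventually at least 1/4. Only an inequality between rationals is decided.
ℂ-local : ∀ z → ℂ-Ring.Regular z ⊎ ℂ-Ring.Regular (1ᶜ ℂ-Ring.- z)
ℂ-local z with cauchy (re z) ¼ (ℚ.positive⁻¹ ¼)
... | N , close with ℚ.≤-total ½ (seq (re z) N)
...   | inj₁ ½≤a = inj₁ (large-re-regular (N , λ n N≤n →
          difference-lower ½≤a (close N n ℕ.≤-refl N≤n)))
...   | inj₂ a≤½ = inj₂ (large-re-regular (N , λ n N≤n →
          difference-lower {p = 1ℚ ℚ.- seq (re z) N} (ℚ.+-monoʳ-≤ 1ℚ (ℚ.neg-antimono-≤ a≤½))
            (≡.subst (λ p → ℚ.∣ p ∣ ℚ.< ¼)
              (solve 2 (λ a b → b :- a := con 1ℚ :- a :- (con 1ℚ :+ :- b)) ≡.refl (seq (re z) N) (seq (re z) n))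
              (close n N N≤n ℕ.≤-refl))))

-- The theorem for complex roots of unity.

open RationalSums ℂ-commutativeRing fromℚ fromℚ-hom 1ᶜ≉0ᶜ square≈0⇒≈0 ℂ-local
  using (Torsion; torsion-ratio)

rootOfUnity⇒torsion : ∀ {z} → IsRootOfUnity z → Torsion z
rootOfUnity⇒torsion root = exponent , ℕ.m<n⇒n≢0 exponent≥1 , z^exponent≈1
  where open IsRootOfUnity root

open import Data.Nat.Base using (_*_; _≥_)

theorem6 : (k : ℕ) → k ≥ 1 →
    (a : ℂ) → ¬ (a ≈ᶜ 0ᶜ) →
    (c c* : Fin k → ℚ)
    (ζ ζ* : Fin k → ℂ)
    (ζ-root : ∀ i → IsRootOfUnity (ζ i))
    (ζ*-root : ∀ j → IsRootOfUnity (ζ* j)) →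
    sumᶜ (λ i → fromℚ (c i) *ᶜ ζ i) ≈ᶜ a →
    sumᶜ (λ j → fromℚ (c* j) *ᶜ ζ* j) ≈ᶜ a →
    (∀ (I : Subset k) → Nonempty I → I ⊂ ⊤ →
    ¬ (sumOver I (λ i → fromℚ (c i) *ᶜ ζ i) ≈ᶜ 0ᶜ)) →
    (∀ (J : Subset k) → Nonempty J → J ⊂ ⊤ →
    ¬ (sumOver J (λ j → fromℚ (c* j) *ᶜ ζ* j) ≈ᶜ 0ᶜ)) →
    ∀ (j : Fin k) → ∃[ i ]
    ((ζ* j /ᶜ ζ i) {{rootOfUnity⇒invertible (ζ-root i)}}) ^ᶜ primorial (2 * k) ≈ᶜ 1ᶜ
theorem6 k _ a a≉0 c c* ζ ζ* ζ-root ζ*-root sum≈a sum*≈a _ subsums*≉0 j =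
  ≡.subst (λ n → ∃[ i ] (ζ* j *ᶜ proj₁ (rootOfUnity⇒invertible (ζ-root i))) ^ᶜ primorial n ≈ᶜ 1ᶜ)
    -- `2 * k` unfolds to `k + (k + 0)`, whereas the combined sum has `k + k` terms.
    (≡.cong (k ℕ.+_) (≡.sym (ℕ.+-identityʳ k)))
    (torsion-ratio c c* ζ ζ*
      (λ i → proj₁ (rootOfUnity⇒invertible (ζ-root i)))
      (λ i → proj₁ (rootOfUnity⇒invertible (ζ*-root i)))
      (λ i → proj₁ (proj₂ (rootOfUnity⇒invertible (ζ-root i))))
      (λ i → proj₂ (proj₂ (rootOfUnity⇒invertible (ζ*-root i))))
      (λ i → rootOfUnity⇒torsion (ζ-root i))
      (λ i → rootOfUnity⇒torsion (ζ*-root i))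
      (ℂ-Ring.trans sum≈a (ℂ-Ring.sym sum*≈a))
      (λ h → a≉0 (ℂ-Ring.trans (ℂ-Ring.sym sum*≈a) h))
      subsums≉0
      j)
  where
  subsums≉0 : ∀ (J : Fin k → Bool) → (∃[ i ] J i ≡ true) → (∃[ i ] J i ≡ false) →
              ¬ (sumᶜ (λ i → if J i then fromℚ (c* i) *ᶜ ζ* i else 0ᶜ) ≈ᶜ 0ᶜ)
  subsums≉0 J (i , i∈J) (i′ , i′∉J) h = subsums*≉0 (tabulate J)
    (i , lookup⇒[]= i (tabulate J) (≡.trans (lookup∘tabulate J i) i∈J))
    (⊆⊤ , i′ , ∈⊤ , i′∉)
    (ℂ-Ring.trans (ℂ-Ring.sum-cong-≋ {k} λ l → ℂ-Ring.reflexive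
      (≡.cong (if_then fromℚ (c* l) *ᶜ ζ* l else 0ᶜ) (lookup∘tabulate J l))) h)
    where
    i′∉ : i′ ∉ tabulate J
    i′∉ i′∈ with () ← ≡.trans (≡.sym ([]=⇒lookup i′∈)) (≡.trans (lookup∘tabulate J i′) i′∉J)
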